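{- There exists no finite affine plane of order $6$ (equivalently, there exists no finite projective plane of order $6$). The finite projective plane of order $7$ is unique up to isomorphism, i.e. a projective plane of order $7$ exists and any two projective planes of order $7$ are isomorphic.
   Context: A finite affine plane of order $n$ is a set $\mathcal{A}=\{P_1,\dots,P_{n^2}\}$ of $n^2$ points together with $n+1$ parallel classes $L_1,\dots,L_{n+1}$, where each $L_i=\{\ell_i^{(0)},\dots,\ell_i^{(n-1)}\}$ is a collection of $n$ distinct, pairwise disjoint (parallel) subsets of $\mathcal{A}$ called lines, each containing exactly $n$ points of $\mathcal{A}$, such that for all $i\neq j$ and all $k,m$ the intersection $\ell_i^{(k)}\cap \ell_j^{(m)}$ consists of exactly one point. A finite projective plane of order $n$ is the disjoint union of (the point set of) a finite affine plane $\mathcal{A}$ of order $n$ and a "line at infinity" $\ell_\infty=\{P_1^{(\infty)},\dots,P_{n+1}^{(\infty)}\}$ of $n+1$ further points. Its lines are $\ell_\infty$ together with the sets $\ell_i^{(k)}\cup\{P_i^{(\infty)}\}$ for $1\le i\le n+1$, $0\le k\le n-1$; that is, $P_i^{(\infty)}$ is the intersection point of any two distinct lines of the parallel class $L_i$. Two projective planes are isomorphic if there is a bijection between their point sets that maps the set of lines of one onto the set of lines of the other. -}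

module Defs where

open import Data.Fin.Base using (Fin)
open import Data.Fin.Permutation using (Permutation; _⟨$⟩ˡ_)
open import Data.Fin.Subset using (Subset; ⊥; ⊤; ⁅_⁆; _∩_; Empty; ∣_∣)
open import Data.Nat.Base using (ℕ; suc; _+_; _*_)
open import Data.Product.Base using (∃; _×_)
open import Data.Vec.Base using (lookup; tabulate; _++_)
open import Relation.Binary.PropositionalEquality using (_≡_; _≢_)

-- The points P₁, …, P_{n²} are identified with their indices, and
-- line i k is the k-th line of the i-th parallel class.
record AffinePlane (n : ℕ) : Set where
  field
    line     : Fin (suc n) → Fin n → Subset (n * n)
    size     : ∀ i k → ∣ line i k ∣ ≡ n
    distinct : ∀ i {k m} → k ≢ m → line i k ≢ line i m
    disjoint : ∀ i {k m} → k ≢ m → Empty (line i k ∩ line i m)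
    meet     : ∀ {i j} → i ≢ j → ∀ k m → ∣ line i k ∩ line j m ∣ ≡ 1

-- In the disjoint union of the affine plane and the line at infinity,
-- the first n * n indices are affine, and the remaining suc n are the
-- points at infinity, one for each parallel class.
#points : ℕ → ℕ
#points n = n * n + suc n

record ProjectivePlane (n : ℕ) : Set where
  field
    affinePlane : AffinePlane n

  open AffinePlane affinePlane using (line)

  -- Concatenating the characteristic vectors of S and T gives the subset
  -- S ∪ T of the disjoint union.
  data IsLine : Subset (#points n) → Set where
    ℓ∞     : IsLine (⊥ {n * n} ++ ⊤ {suc n})
    ℓ[_,_] : ∀ i k → IsLine (line i k ++ ⁅ i ⁆)

open ProjectivePlane public using (IsLine)

-- y lies in the image of S under π exactly when π⁻¹ y lies in S.
image : ∀ {m n} → Permutation m n → Subset m → Subset n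
image π S = tabulate λ y → lookup S (π ⟨$⟩ˡ y)

infix 4 _≅_

record _≅_ {m n : ℕ} (Π : ProjectivePlane m) (Π′ : ProjectivePlane n) : Set where
  field
    bijection : Permutation (#points m) (#points n)
    into      : ∀ {ℓ} → IsLine Π ℓ → IsLine Π′ (image bijection ℓ)
    onto      : ∀ {ℓ′} → IsLine Π′ ℓ′ → ∃ λ ℓ → IsLine Π ℓ × image bijection ℓ ≡ ℓ′

-- Order 6 is excluded by the argument of Bruck and Ryser.  If the 42 affine lines ℓ
-- carry unknowns x ℓ, and M q is the sum of the x ℓ over the lines ℓ through q, points
-- at infinity included, then Σ (M q)² = s² + 6 Σ (x ℓ)² with s = Σ x ℓ.  With two more
-- unknowns b and c, a substitution by quaternions of norm 6 turns b² + c² + Σ (x ℓ)²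
-- into 6 Σ (y i)² with 44 = 4 · 11 unknowns y i.  Solving the 43 linear equations
-- 6 y i = ± M q leaves a² + s² = 6 (b² + c²) with a = 6 y i ≢ 0 for the one remaining i,
-- which is impossible by descent modulo 3.
--
-- For order 7, two parallel classes serve as coordinates, so that each line of the
-- other six classes is the graph of a permutation σ c b of 0, …, 6.  After relabelling,
-- σ c b sends 0 to b, σ 0 0 is the identity, σ 1 0 fixes only 0 and has one of four
-- normal forms, and σ c 0 sends 1 to c + 1.  A forward-checking search over the 42
-- permutations then finds only planes whose lines become y = m x + b over ℤ/7 under a
-- further relabelling of 0, …, 6.

module Submission where

open import Defs
open import Data.Bool.Base using (Bool; true; false; T; not; if_then_else_; _∧_)
open import Data.Fin.Base
  using (Fin; zero; suc; toℕ; fromℕ; fromℕ<; inject₁; punchOut; combine; remQuot; splitAt; join; _↑ˡ_; _↑ʳ_)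
open import Data.Fin.Patterns using (0F; 1F)
open import Data.Fin.Permutation
  using (Permutation′; permutation; _⟨$⟩ʳ_; _⟨$⟩ˡ_; inverseˡ; inverseʳ; flip; lift₀; _∘ₚ_)
  renaming (id to idₚ)
open import Data.Fin.Properties
  using (_≟_; any?; all?; injective⇒≤; punchOut-injective; punchIn-punchOut; toℕ<n; toℕ-injective; toℕ-fromℕ<;
         suc-injective; 0≢1+n; combine-remQuot; combine-surjective; combine-injective; +↔⊎; splitAt-join)
open import Data.Nat.Base as ℕ using (ℕ; zero; suc)
import Data.Nat.Properties as ℕ
open import Data.Product.Base using (_×_; _,_; proj₁; proj₂; ∃; ∃-syntax; Σ-syntax; uncurry)
open import Data.Sum.Base as Sum using (_⊎_; inj₁; inj₂; [_,_]′)
open import Data.Unit.Base using (tt)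
open import Function.Base using (_∘_; _$_; id)
open import Function.Bundles using (Equivalence; mk⇔)
open import Function.Definitions using (Injective)
open import Relation.Binary.PropositionalEquality
open import Relation.Nullary using (¬_; yes; no; contradiction)
open import Relation.Nullary.Decidable using (T?; from-yes; _⊎-dec_; _→-dec_; _×-dec_)

-- Injective self-maps of finite sets.

opaque
  -- A missed value `y` could be punched out, which would inject `suc n` elements into `n`.
  injective⇒surjective : ∀ {n} {f : Fin n → Fin n} → Injective _≡_ _≡_ f → ∀ y → ∃ λ x → f x ≡ y
  injective⇒surjective {suc n} {f} inj y with any? (λ x → f x ≟ y)
  ... | yes hit = hit
  ... | no miss = contradiction (injective⇒≤ {f = λ x → punchOut (avoids x)}
                                  (λ e → inj (punchOut-injective (avoids _) (avoids _) e))) ℕ.1+n≰n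
    where
    avoids : ∀ x → y ≢ f x
    avoids x e = miss (x , sym e)

injective⇒permutation : ∀ {n} (f : Fin n → Fin n) → Injective _≡_ _≡_ f → Permutation′ n
injective⇒permutation f inj =
  permutation f (λ y → proj₁ (onto y)) (λ y → proj₂ (onto y)) (λ x → inj (proj₂ (onto (f x))))
  where onto = injective⇒surjective inj

permutation-injective : ∀ {n} (π : Permutation′ n) → Injective _≡_ _≡_ (π ⟨$⟩ʳ_)
permutation-injective π {x} {y} e = trans (sym (inverseˡ π)) (trans (cong (π ⟨$⟩ˡ_) e) (inverseˡ π))

-- Descent modulo 3 for sums of two squares.

module SumsOfSquares where
  open import Data.Nat.Base using (_+_; _*_; _%_; _<_; s≤s; z≤n; ≢-nonZero)
  open import Data.Nat.Divisibility using (_∣_; divides; m%n≡0⇒n∣m; n∣m⇒m%n≡0; m∣m*n)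
  open import Data.Nat.DivMod using (_mod_; m%n<n; %-distribˡ-+; %-distribˡ-*)
  open import Data.Nat.Induction using (<-wellFounded)
  open import Data.Nat.Primality using (prime?; euclidsLemma)
  open import Data.Nat.Tactic.RingSolver using (solve-∀)
  open import Induction.WellFounded using (Acc; acc)

  -- Squares are 0 or 1 modulo 3, so a sum of two squares vanishes only if both do; `residues`
  -- decides the nine cases.
  3∣m²+n²⇒3∣m×3∣n : ∀ m n → 3 ∣ m * m + n * n → 3 ∣ m × 3 ∣ n
  3∣m²+n²⇒3∣m×3∣n m n 3∣ =
    let r≡0 , t≡0 = residues (m mod 3) (n mod 3) (trans (sym reduce) (n∣m⇒m%n≡0 (m * m + n * n) 3 3∣))
    in  m%n≡0⇒n∣m m 3 (trans (sym (toℕ-mod m)) r≡0) , m%n≡0⇒n∣m n 3 (trans (sym (toℕ-mod n)) t≡0)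
    where
    residues : ∀ (r t : Fin 3) → ((toℕ r * toℕ r) % 3 + (toℕ t * toℕ t) % 3) % 3 ≡ 0 → toℕ r ≡ 0 × toℕ t ≡ 0
    residues = from-yes (all? λ (r : Fin 3) → all? λ (t : Fin 3) →
      (((toℕ r * toℕ r) % 3 + (toℕ t * toℕ t) % 3) % 3 ℕ.≟ 0) →-dec ((toℕ r ℕ.≟ 0) ×-dec (toℕ t ℕ.≟ 0)))

    toℕ-mod : ∀ k → toℕ (k mod 3) ≡ k % 3
    toℕ-mod k = toℕ-fromℕ< (m%n<n k 3)

    square : ∀ k → (k * k) % 3 ≡ (toℕ (k mod 3) * toℕ (k mod 3)) % 3
    square k rewrite toℕ-mod k = %-distribˡ-* k k 3

    reduce : (m * m + n * n) % 3 ≡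
             ((toℕ (m mod 3) * toℕ (m mod 3)) % 3 + (toℕ (n mod 3) * toℕ (n mod 3)) % 3) % 3
    reduce = trans (%-distribˡ-+ (m * m) (n * n) 3) (cong₂ (λ x y → (x + y) % 3) (square m) (square n))

  private
    tripled : ∀ a b → (a * 3) * (a * 3) + (b * 3) * (b * 3) ≡ 3 * (3 * (a * a + b * b))
    tripled = solve-∀

  -- Infinite descent. Since 3 divides m and n, one factor 3 cancels and leaves 3 (m′² + n′²) = 2
  -- (k² + l²), so 3 divides k and l as well, and the four thirds satisfy the original equation.
  m²+n²≡6[k²+l²]⇒m≡0 : ∀ m n k l → m * m + n * n ≡ 6 * (k * k + l * l) → m ≡ 0
  m²+n²≡6[k²+l²]⇒m≡0 m = descend m (<-wellFounded m)
    where
    open ≡-Reasoning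
    descend : ∀ m → Acc _<_ m → ∀ n k l → m * m + n * n ≡ 6 * (k * k + l * l) → m ≡ 0
    descend m (acc rec) n k l e
      with divides m′ refl , divides n′ refl ← 3∣m²+n²⇒3∣m×3∣n m n
             (subst (3 ∣_) (sym (trans e (ℕ.*-assoc 3 2 (k * k + l * l)))) (m∣m*n (2 * (k * k + l * l))))
      with e′ ← ℕ.*-cancelˡ-≡ (3 * (m′ * m′ + n′ * n′)) (2 * (k * k + l * l)) 3
             (trans (sym (tripled m′ n′)) (trans e (ℕ.*-assoc 3 2 (k * k + l * l))))
      with euclidsLemma 2 (k * k + l * l) (from-yes (prime? 3)) (subst (3 ∣_) e′ (m∣m*n (m′ * m′ + n′ * n′)))
    ... | inj₁ 3∣2 = contradiction (n∣m⇒m%n≡0 2 3 3∣2) λ ()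
    ... | inj₂ 3∣
      with divides k′ refl , divides l′ refl ← 3∣m²+n²⇒3∣m×3∣n k l 3∣
      -- The descent needs m′ < 3 m′, which fails only for m′ = 0, where the claim is immediate.
      with m′ ℕ.≟ 0
    ... | yes m′≡0 = cong (_* 3) m′≡0
    ... | no  m′≢0 = contradiction (descend m′ (rec m′<m) n′ k′ l′
      (ℕ.*-cancelˡ-≡ (m′ * m′ + n′ * n′) (6 * (k′ * k′ + l′ * l′)) 3 (begin
        3 * (m′ * m′ + n′ * n′)                     ≡⟨ e′ ⟩
        2 * ((k′ * 3) * (k′ * 3) + (l′ * 3) * (l′ * 3)) ≡⟨ cong (2 *_) (tripled k′ l′) ⟩
        2 * (3 * (3 * (k′ * k′ + l′ * l′)))         ≡⟨ regroup (k′ * k′ + l′ * l′) ⟩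
        3 * (6 * (k′ * k′ + l′ * l′))               ∎))) m′≢0
      where
      regroup : ∀ x → 2 * (3 * (3 * x)) ≡ 3 * (6 * x)
      regroup = solve-∀

      m′<m : m′ < m′ * 3
      m′<m = ℕ.m<m*n m′ 3 {{≢-nonZero m′≢0}} (s≤s (s≤s z≤n))

-- Integral linear forms and the elimination of unknowns.

module OrderSix where
  open import Data.Empty using (⊥)
  open import Data.Fin.Subset
    using (Subset; inside; outside; ⁅_⁆; Empty) renaming (∣_∣ to ∣_∣ₛ; _∩_ to _∩ₛ_)
  open import Data.Fin.Subset.Properties using (∩-idem; ∣⁅x⁆∣≡1; ∣⊥∣≡0; Empty-unique; x∈p∩q⁻; x∈⁅y⁆⇒x≡y)
  open import Data.Integer.Base using (ℤ; +_; -[1+_]; 0ℤ; 1ℤ; -1ℤ; _+_; _*_; _-_; ∣_∣)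
  open import Data.Integer.Properties
    using (+-*-semiring; +-identityˡ; +-assoc; +-injective; *-identityˡ; *-zeroʳ; *-assoc; *-distribˡ-+;
           pos-+; pos-*; i*j≡0⇒i≡0∨j≡0; ∣i∣≡0⇒i≡0)
  import Data.Integer.Properties as ℤ
  open import Data.Integer.Tactic.RingSolver using (solve-∀)
  open import Data.Vec.Base using (Vec; []; _∷_; lookup; map; zipWith; replicate; _++_)
  open import Data.Vec.Properties using (lookup-map; lookup-zipWith; zipWith-++)
  open import Algebra.Properties.Semiring.Sum +-*-semiring
    using (sum; sum-cong-≗; ∑-distrib-+; ∑-comm; sum-init-last; *-distribˡ-sum; *-distribʳ-sum)
  open SumsOfSquares using (m²+n²≡6[k²+l²]⇒m≡0)

  infixl 6 _⊞_
  infixr 7 _⊡_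

  _⊞_ : ∀ {n} → Vec ℤ n → Vec ℤ n → Vec ℤ n
  _⊞_ = zipWith _+_

  _⊡_ : ∀ {n} → ℤ → Vec ℤ n → Vec ℤ n
  c ⊡ v = map (c *_) v

  -- Linearity is a property of functions rather than a list of coefficients, so that substitutions
  -- are plain compositions and need no matrices.
  record IsLinear {n} (f : Vec ℤ n → ℤ) : Set where
    field
      additive    : ∀ u v → f (u ⊞ v) ≡ f u + f v
      homogeneous : ∀ c v → f (c ⊡ v) ≡ c * f v

  record IsLinearMap {m n} (F : Vec ℤ m → Vec ℤ n) : Set where
    field
      additive    : ∀ u v → F (u ⊞ v) ≡ F u ⊞ F v
      homogeneous : ∀ c v → F (c ⊡ v) ≡ c ⊡ F v

  ∘-isLinear : ∀ {m n} {f : Vec ℤ n → ℤ} {F : Vec ℤ m → Vec ℤ n} →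
               IsLinear f → IsLinearMap F → IsLinear (f ∘ F)
  ∘-isLinear {f = f} {F} fl Fl = record
    { additive    = λ u v → trans (cong f (F.additive u v)) (f.additive (F u) (F v))
    ; homogeneous = λ c v → trans (cong f (F.homogeneous c v)) (f.homogeneous c (F v))
    }
    where module f = IsLinear fl
          module F = IsLinearMap Fl

  lookup-isLinear : ∀ {n} (i : Fin n) → IsLinear (λ v → lookup v i)
  lookup-isLinear i = record
    { additive    = λ u v → lookup-zipWith _+_ i u v
    ; homogeneous = λ c v → lookup-map i (c *_) v
    }

  combination-isLinear : ∀ {m n} (a : Fin m → ℤ) (f : Fin m → Vec ℤ n → ℤ) → (∀ i → IsLinear (f i)) →
                         IsLinear (λ v → sum (λ i → a i * f i v))
  combination-isLinear a f fl = record
    { additive    = λ u v → trans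
        (sum-cong-≗ λ i → trans (cong (a i *_) (additive i u v)) (*-distribˡ-+ (a i) (f i u) (f i v)))
        (∑-distrib-+ (λ i → a i * f i u) (λ i → a i * f i v))
    ; homogeneous = λ c v → trans
        (sum-cong-≗ λ i → trans (cong (a i *_) (homogeneous i c v)) (exchange (a i) c (f i v)))
        (sym (*-distribˡ-sum c (λ i → a i * f i v)))
    }
    where
    open module L i = IsLinear (fl i)
    exchange : ∀ a c x → a * (c * x) ≡ c * (a * x)
    exchange = solve-∀

  e₀ : ∀ {n} → Vec ℤ (suc n)
  e₀ = 1ℤ ∷ replicate _ 0ℤ

  ∷-decompose : ∀ {n} x (v : Vec ℤ n) → x ∷ v ≡ x ⊡ e₀ ⊞ (0ℤ ∷ v)
  ∷-decompose x v = cong₂ _∷_ (head x) (tail v)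
    where
    head : ∀ x → x ≡ x * 1ℤ + 0ℤ
    head = solve-∀
    tail : ∀ {n} (v : Vec ℤ n) → v ≡ x ⊡ replicate n 0ℤ ⊞ v
    tail []      = refl
    tail (y ∷ v) = cong₂ _∷_ (sym (trans (cong (_+ y) (*-zeroʳ x)) (+-identityˡ y))) (tail v)

  0∷-isLinearMap : ∀ {n} → IsLinearMap {n} (0ℤ ∷_)
  0∷-isLinearMap = record
    { additive    = λ _ _ → refl
    ; homogeneous = λ c v → cong (_∷ c ⊡ v) (sym (*-zeroʳ c))
    }

  -- If a - m and a + m both vanished, so would their sum 2 a.
  choose-sign : ∀ a m → a ≢ 0ℤ → ∃[ s ] s * s ≡ 1ℤ × a - s * m ≢ 0ℤ
  choose-sign a m a≢0 with a - 1ℤ * m ℤ.≟ 0ℤ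
  ... | no  a≢m = 1ℤ , refl , a≢m
  ... | yes a≡m = -1ℤ , refl , λ a≡-m →
    [ (λ ()) , a≢0 ]′ (i*j≡0⇒i≡0∨j≡0 (+ 2) (trans (double a m) (cong₂ _+_ a≡m a≡-m)))
    where
    double : ∀ a m → + 2 * a ≡ (a - 1ℤ * m) + (a - -1ℤ * m)
    double = solve-∀

  -- Eliminating the unknowns one at a time, the sign in a yᵢ = ± Mᵢ(y) is chosen
  -- so that the coefficient of yᵢ does not vanish; the last unknown stays free.
  match-squares : ∀ k (a : ℤ) → a ≢ 0ℤ → (M : Fin k → Vec ℤ (suc k) → ℤ) → (∀ i → IsLinear (M i)) →
                  ∃[ y ] lookup y (fromℕ k) ≢ 0ℤ ×
                         (∀ i → (a * lookup y (inject₁ i)) * (a * lookup y (inject₁ i)) ≡ M i y * M i y)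
  match-squares zero    a a≢0 M M-linear = 1ℤ ∷ [] , (λ ()) , λ ()
  match-squares (suc k) a a≢0 M M-linear =
    let s , s²≡1 , d≢0 = choose-sign a m a≢0
        open Elimination s s²≡1
        -- The remaining unknowns are `d` times the entries of `w`, so in terms of `w` their
        -- coefficient is `a * d` in place of `a`.
        w , last≢0 , squares = match-squares k (a * d) ([ a≢0 , d≢0 ]′ ∘ i*j≡0⇒i≡0∨j≡0 a)
                                 (λ i → M (suc i) ∘ φ) (λ i → ∘-isLinear (M-linear (suc i)) φ-linear)
    in  φ w
      , (λ e → [ d≢0 , last≢0 ]′ (i*j≡0⇒i≡0∨j≡0 d (trans (sym (lookup-map (fromℕ k) (d *_) w)) e)))
      , λ where
          zero    → head-square w
          (suc i) → trans (cong (λ z → z * z) (trans (cong (a *_) (lookup-map (inject₁ i) (d *_) w))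
                                                     (sym (*-assoc a d (lookup w (inject₁ i))))))
                          (squares i)
    where
    open IsLinear (M-linear zero)
    m = M zero e₀

    rest : Vec ℤ (suc k) → ℤ
    rest w = M zero (0ℤ ∷ w)

    rest-linear : IsLinear rest
    rest-linear = ∘-isLinear (M-linear zero) 0∷-isLinearMap

    module Elimination (s : ℤ) (s²≡1 : s * s ≡ 1ℤ) where
      d = a - s * m

      -- The equation a y₀ = s M₀(y) amounts to d y₀ = s times the contribution of the other
      -- unknowns. Scaling those by `d` makes the solution y₀ integral without any division.
      φ : Vec ℤ (suc k) → Vec ℤ (suc (suc k))
      φ w = s * rest w ∷ d ⊡ w

      φ-linear : IsLinearMap φ
      φ-linear = record
        { additive    = λ u v → cong₂ _∷_
            (trans (cong (s *_) (IsLinear.additive rest-linear u v)) (*-distribˡ-+ s (rest u) (rest v)))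
            (⊡-⊞ d u v)
        ; homogeneous = λ c v → cong₂ _∷_
            (trans (cong (s *_) (IsLinear.homogeneous rest-linear c v)) (exchange s c (rest v)))
            (⊡-⊡ d c v)
        }
        where
        exchange : ∀ a c x → a * (c * x) ≡ c * (a * x)
        exchange = solve-∀
        ⊡-⊞ : ∀ {n} d (u v : Vec ℤ n) → d ⊡ (u ⊞ v) ≡ d ⊡ u ⊞ d ⊡ v
        ⊡-⊞ d []      []      = refl
        ⊡-⊞ d (x ∷ u) (y ∷ v) = cong₂ _∷_ (*-distribˡ-+ d x y) (⊡-⊞ d u v)
        ⊡-⊡ : ∀ {n} d c (v : Vec ℤ n) → d ⊡ c ⊡ v ≡ c ⊡ d ⊡ v
        ⊡-⊡ d c []      = refl
        ⊡-⊡ d c (x ∷ v) = cong₂ _∷_ (exchange d c x) (⊡-⊡ d c v)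

      M₀-φ : ∀ w → M zero (φ w) ≡ a * rest w
      M₀-φ w = begin
        M zero (φ w)
          ≡⟨ cong (M zero) (∷-decompose (s * rest w) (d ⊡ w)) ⟩
        M zero ((s * rest w) ⊡ e₀ ⊞ (0ℤ ∷ d ⊡ w))
          ≡⟨ additive _ _ ⟩
        M zero ((s * rest w) ⊡ e₀) + rest (d ⊡ w)
          ≡⟨ cong₂ _+_ (homogeneous (s * rest w) e₀) (IsLinear.homogeneous rest-linear d w) ⟩
        (s * rest w) * m + (a - s * m) * rest w
          ≡⟨ collect a s m (rest w) ⟩
        a * rest w ∎
        where
        open ≡-Reasoning
        collect : ∀ a s m r → (s * r) * m + (a - s * m) * r ≡ a * r
        collect = solve-∀

      head-square : ∀ w → (a * (s * rest w)) * (a * (s * rest w)) ≡ M zero (φ w) * M zero (φ w)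
      head-square w = begin
        (a * (s * rest w)) * (a * (s * rest w))      ≡⟨ pull-sign a s (rest w) ⟩
        (s * s) * ((a * rest w) * (a * rest w))      ≡⟨ cong (_* _) s²≡1 ⟩
        1ℤ * ((a * rest w) * (a * rest w))           ≡⟨ *-identityˡ _ ⟩
        (a * rest w) * (a * rest w)                  ≡⟨ cong (λ z → z * z) (M₀-φ w) ⟨
        M zero (φ w) * M zero (φ w)                  ∎
        where
        open ≡-Reasoning
        pull-sign : ∀ a s r → (a * (s * r)) * (a * (s * r)) ≡ (s * s) * ((a * r) * (a * r))
        pull-sign = solve-∀

  -- Sums of squares and quaternions of norm 6.

  sumSquares : ∀ {n} → (Fin n → ℤ) → ℤ
  sumSquares x = sum λ i → x i * x i

  -- Each block of four is multiplied by a quaternion of norm 6 = 2² + 1² + 1² + 0².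
  rotate : ∀ m → Vec ℤ (m ℕ.* 4) → Vec ℤ (m ℕ.* 4)
  rotate zero    []                  = []
  rotate (suc m) (a ∷ b ∷ c ∷ d ∷ v)
    = + 2 * a + b + c
    ∷ + 2 * b + d - a
    ∷ + 2 * c - d - a
    ∷ + 2 * d + c - b
    ∷ rotate m v

  rotate-isLinearMap : ∀ m → IsLinearMap (rotate m)
  rotate-isLinearMap m = record { additive = additive m ; homogeneous = homogeneous m }
    where
    add₊₊ : ∀ a b c a′ b′ c′ → + 2 * (a + a′) + (b + b′) + (c + c′) ≡ (+ 2 * a + b + c) + (+ 2 * a′ + b′ + c′)
    add₊₊ = solve-∀
    add₊₋ : ∀ a b c a′ b′ c′ → + 2 * (a + a′) + (b + b′) - (c + c′) ≡ (+ 2 * a + b - c) + (+ 2 * a′ + b′ - c′)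
    add₊₋ = solve-∀
    add₋₋ : ∀ a b c a′ b′ c′ → + 2 * (a + a′) - (b + b′) - (c + c′) ≡ (+ 2 * a - b - c) + (+ 2 * a′ - b′ - c′)
    add₋₋ = solve-∀
    mul₊₊ : ∀ k a b c → + 2 * (k * a) + k * b + k * c ≡ k * (+ 2 * a + b + c)
    mul₊₊ = solve-∀
    mul₊₋ : ∀ k a b c → + 2 * (k * a) + k * b - k * c ≡ k * (+ 2 * a + b - c)
    mul₊₋ = solve-∀
    mul₋₋ : ∀ k a b c → + 2 * (k * a) - k * b - k * c ≡ k * (+ 2 * a - b - c)
    mul₋₋ = solve-∀

    additive : ∀ m u v → rotate m (u ⊞ v) ≡ rotate m u ⊞ rotate m v
    additive zero    []                  []                      = refl
    additive (suc m) (a ∷ b ∷ c ∷ d ∷ u) (a′ ∷ b′ ∷ c′ ∷ d′ ∷ v) =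
      cong₂ _∷_ (add₊₊ a b c a′ b′ c′) (cong₂ _∷_ (add₊₋ b d a b′ d′ a′)
        (cong₂ _∷_ (add₋₋ c d a c′ d′ a′) (cong₂ _∷_ (add₊₋ d c b d′ c′ b′) (additive m u v))))

    homogeneous : ∀ m k v → rotate m (k ⊡ v) ≡ k ⊡ rotate m v
    homogeneous zero    k []                  = refl
    homogeneous (suc m) k (a ∷ b ∷ c ∷ d ∷ v) =
      cong₂ _∷_ (mul₊₊ k a b c) (cong₂ _∷_ (mul₊₋ k b d a)
        (cong₂ _∷_ (mul₋₋ k c d a) (cong₂ _∷_ (mul₊₋ k d c b) (homogeneous m k v))))

  -- Euler's four-square identity in each block, one of its two factors being 6.
  sumSquares-rotate : ∀ m v → sumSquares (lookup (rotate m v)) ≡ + 6 * sumSquares (lookup v)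
  sumSquares-rotate zero    []                  = refl
  sumSquares-rotate (suc m) (a ∷ b ∷ c ∷ d ∷ v) = trans
    (cong (λ r → w * w + (x * x + (y * y + (z * z + r)))) (sumSquares-rotate m v))
    (norm a b c d (sumSquares (lookup v)))
    where
    w = + 2 * a + b + c
    x = + 2 * b + d - a
    y = + 2 * c - d - a
    z = + 2 * d + c - b
    norm : ∀ a b c d r →
      (+ 2 * a + b + c) * (+ 2 * a + b + c) + ((+ 2 * b + d - a) * (+ 2 * b + d - a) +
        ((+ 2 * c - d - a) * (+ 2 * c - d - a) + ((+ 2 * d + c - b) * (+ 2 * d + c - b) + + 6 * r)))
      ≡ + 6 * (a * a + (b * b + (c * c + (d * d + r))))
    norm = solve-∀

  -- Incidence matrices and the Bruck-Ryser contradiction.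

  indicator : Bool → ℤ
  indicator b = if b then 1ℤ else 0ℤ

  sum-indicator : ∀ {n} (p : Subset n) → sum (λ i → indicator (lookup p i)) ≡ + ∣ p ∣ₛ
  sum-indicator []            = refl
  sum-indicator (inside  ∷ p) = cong (λ s → 1ℤ + s) (sum-indicator p)
  sum-indicator (outside ∷ p) = trans (+-identityˡ _) (sum-indicator p)

  sum-indicator-∩ : ∀ {n} (p q : Subset n) →
                    sum (λ i → indicator (lookup p i) * indicator (lookup q i)) ≡ + ∣ p ∩ₛ q ∣ₛ
  sum-indicator-∩ p q = trans
    (sum-cong-≗ λ i → trans (indicator-∧ (lookup p i) (lookup q i))
                            (cong indicator (sym (lookup-zipWith _∧_ i p q))))
    (sum-indicator (p ∩ₛ q))
    where
    indicator-∧ : ∀ a b → indicator a * indicator b ≡ indicator (a ∧ b)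
    indicator-∧ true  b = *-identityˡ (indicator b)
    indicator-∧ false b = refl

  module Gram {l k} (A : Fin l → Fin k → ℤ) (x : Fin l → ℤ) where
    open ≡-Reasoning

    form : Fin k → ℤ
    form q = sum λ j → A j q * x j

    product : Fin l → Fin l → ℤ
    product i j = sum λ q → A i q * A j q

    row : ∀ i → sum (λ q → A i q * form q) ≡ sum (λ j → product i j * x j)
    row i = begin
      sum (λ q → A i q * form q)
        ≡⟨ sum-cong-≗ (λ q → *-distribˡ-sum (A i q) (λ j → A j q * x j)) ⟩
      sum (λ q → sum (λ j → A i q * (A j q * x j)))
        ≡⟨ ∑-comm (λ q j → A i q * (A j q * x j)) ⟩
      sum (λ j → sum (λ q → A i q * (A j q * x j)))
        ≡⟨ sum-cong-≗ (λ j → trans (sum-cong-≗ λ q → sym (*-assoc (A i q) (A j q) (x j)))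
                                   (sym (*-distribʳ-sum (x j) (λ q → A i q * A j q)))) ⟩
      sum (λ j → product i j * x j) ∎

    -- With `form` = Aᵀ x and `product` = A Aᵀ, this is |Aᵀ x|² = xᵀ (A Aᵀ) x; only the order of
    -- finite sums changes.
    sumSquares-form : sumSquares form ≡ sum (λ i → x i * sum (λ j → product i j * x j))
    sumSquares-form = begin
      sum (λ q → form q * form q)
        ≡⟨ sum-cong-≗ (λ q → *-distribʳ-sum (form q) (λ i → A i q * x i)) ⟩
      sum (λ q → sum (λ i → A i q * x i * form q))
        ≡⟨ ∑-comm (λ q i → A i q * x i * form q) ⟩
      sum (λ i → sum (λ q → A i q * x i * form q))
        ≡⟨ sum-cong-≗ (λ i → trans (sum-cong-≗ λ q → exchange (A i q) (x i) (form q))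
                                   (sym (*-distribˡ-sum (x i) (λ q → A i q * form q)))) ⟩
      sum (λ i → x i * sum (λ q → A i q * form q))
        ≡⟨ sum-cong-≗ (λ i → cong (x i *_) (row i)) ⟩
      sum (λ i → x i * sum (λ j → product i j * x j)) ∎
      where
      exchange : ∀ a b c → a * b * c ≡ b * (a * c)
      exchange = solve-∀

  -- One row of (J + n I) x, where J is the all-ones matrix. The Gram matrix of lines that meet
  -- pairwise in one point has this shape.
  sum-diagonal : ∀ {l} n (i : Fin l) (g x : Fin l → ℤ) → g i ≡ 1ℤ + n → (∀ j → j ≢ i → g j ≡ 1ℤ) →
                 sum (λ j → g j * x j) ≡ sum x + n * x i
  sum-diagonal n zero g x diag off = trans
    (cong₂ _+_ (cong (_* x zero) diag)
      (sum-cong-≗ λ j → trans (cong (_* x (suc j)) (off (suc j) λ ())) (*-identityˡ (x (suc j)))))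
    (collect n (x zero) (sum (x ∘ suc)))
    where
    collect : ∀ n y s → (1ℤ + n) * y + s ≡ y + s + n * y
    collect = solve-∀
  sum-diagonal n (suc i) g x diag off = trans
    (cong₂ _+_ (trans (cong (_* x zero) (off zero λ ())) (*-identityˡ (x zero)))
      (sum-diagonal n i (g ∘ suc) (x ∘ suc) diag λ j j≢i → off (suc j) λ { refl → j≢i refl }))
    (sym (+-assoc (x zero) (sum (x ∘ suc)) (n * x (suc i))))

  -- Splits off the last two coordinates, which will be the extra unknowns `b` and `c`.
  sum-↑ : ∀ l (f : Fin (l ℕ.+ 2) → ℤ) →
          sum f ≡ sum (λ i → f (i ↑ˡ 2)) + (f (l ↑ʳ 0F) + f (l ↑ʳ 1F))
  sum-↑ zero    f = last (f 0F) (f 1F)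
    where
    last : ∀ a b → a + (b + 0ℤ) ≡ 0ℤ + (a + b)
    last = solve-∀
  sum-↑ (suc l) f = trans (cong (λ s → f zero + s) (sum-↑ l (f ∘ suc))) (sym (+-assoc (f zero) _ _))

  square-∣∣ : ∀ i → i * i ≡ + (∣ i ∣ ℕ.* ∣ i ∣)
  square-∣∣ (+ n)    = sym (pos-* n n)
  square-∣∣ -[1+ n ] = refl

  i²+j²≡6[k²+l²]⇒i≡0 : ∀ i j k l → i * i + j * j ≡ + 6 * (k * k + l * l) → i ≡ 0ℤ
  i²+j²≡6[k²+l²]⇒i≡0 i j k l e = ∣i∣≡0⇒i≡0 (m²+n²≡6[k²+l²]⇒m≡0 (∣ i ∣) (∣ j ∣) (∣ k ∣) (∣ l ∣) (+-injective (begin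
    + (∣ i ∣ ℕ.* ∣ i ∣ ℕ.+ ∣ j ∣ ℕ.* ∣ j ∣)              ≡⟨ squares i j ⟩
    i * i + j * j                                        ≡⟨ e ⟩
    + 6 * (k * k + l * l)                                ≡⟨ cong (+ 6 *_) (squares k l) ⟨
    + 6 * + (∣ k ∣ ℕ.* ∣ k ∣ ℕ.+ ∣ l ∣ ℕ.* ∣ l ∣)        ≡⟨ pos-* 6 (∣ k ∣ ℕ.* ∣ k ∣ ℕ.+ ∣ l ∣ ℕ.* ∣ l ∣) ⟨
    + (6 ℕ.* (∣ k ∣ ℕ.* ∣ k ∣ ℕ.+ ∣ l ∣ ℕ.* ∣ l ∣))      ∎)))
    where
    open ≡-Reasoning
    squares : ∀ i j → + (∣ i ∣ ℕ.* ∣ i ∣ ℕ.+ ∣ j ∣ ℕ.* ∣ j ∣) ≡ i * i + j * j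
    squares i j = trans (pos-+ (∣ i ∣ ℕ.* ∣ i ∣) (∣ j ∣ ℕ.* ∣ j ∣))
                        (cong₂ _+_ (sym (square-∣∣ i)) (sym (square-∣∣ j)))

  -- `T` turns the k + 1 unknowns `y` into the weights `x` of the l sets, followed by `b` and `c`.
  -- The sets have 7 elements, as each line of order 6 has a point at infinity besides its 6 affine
  -- points.
  no-rotated-family : ∀ {k l} (S : Fin l → Subset k) →
    (∀ i → ∣ S i ∩ₛ S i ∣ₛ ≡ 7) → (∀ {i j} → i ≢ j → ∣ S i ∩ₛ S j ∣ₛ ≡ 1) →
    (T : Vec ℤ (suc k) → Vec ℤ (l ℕ.+ 2)) → IsLinearMap T →
    (∀ v → sumSquares (lookup (T v)) ≡ + 6 * sumSquares (lookup v)) → ⊥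
  no-rotated-family {k} {l} S diag off T T-linear T-norm =
    let y , last≢0 , squares = match-squares k (+ 6) (λ ()) M M-linear
        open Solution y squares
    -- By `balance`, the descent makes 6 times the free unknown zero, yet `match-squares` chose that
    -- unknown nonzero.
    in  [ (λ ()) , last≢0 ]′ (i*j≡0⇒i≡0∨j≡0 (+ 6) {lookup y (fromℕ k)}
          (i²+j²≡6[k²+l²]⇒i≡0 (+ 6 * lookup y (fromℕ k)) s b c balance))
    where
    A : Fin l → Fin k → ℤ
    A i q = indicator (lookup (S i) q)

    component : Fin l → Vec ℤ (suc k) → ℤ
    component i v = lookup (T v) (i ↑ˡ 2)

    M : Fin k → Vec ℤ (suc k) → ℤ
    M q v = sum λ i → A i q * component i v

    M-linear : ∀ q → IsLinear (M q)
    M-linear q = combination-isLinear (λ i → A i q) component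
      (λ i → ∘-isLinear (lookup-isLinear (i ↑ˡ 2)) T-linear)

    module Solution (y : Vec ℤ (suc k)) (squares : ∀ i →
        (+ 6 * lookup y (inject₁ i)) * (+ 6 * lookup y (inject₁ i)) ≡ M i y * M i y) where
      open ≡-Reasoning
      x : Fin l → ℤ
      x i = component i y

      s b c Q : ℤ
      s = sum x
      b = lookup (T y) (l ↑ʳ 0F)
      c = lookup (T y) (l ↑ʳ 1F)
      Q = sumSquares x

      open Gram A x

      gram-row : ∀ i → sum (λ j → product i j * x j) ≡ s + + 6 * x i
      gram-row i = sum-diagonal (+ 6) i (product i) x
        (trans (sum-indicator-∩ (S i) (S i)) (cong +_ (diag i)))
        (λ j j≢i → trans (sum-indicator-∩ (S i) (S j)) (cong +_ (off (j≢i ∘ sym))))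

      forms : sumSquares form ≡ s * s + + 6 * Q
      forms = begin
        sumSquares form
          ≡⟨ sumSquares-form ⟩
        sum (λ i → x i * sum (λ j → product i j * x j))
          ≡⟨ sum-cong-≗ (λ i → trans (cong (x i *_) (gram-row i)) (expand s (x i))) ⟩
        sum (λ i → x i * s + + 6 * (x i * x i))
          ≡⟨ ∑-distrib-+ (λ i → x i * s) (λ i → + 6 * (x i * x i)) ⟩
        sum (λ i → x i * s) + sum (λ i → + 6 * (x i * x i))
          ≡⟨ cong₂ _+_ (*-distribʳ-sum s x) (*-distribˡ-sum (+ 6) (λ i → x i * x i)) ⟨
        s * s + + 6 * Q ∎
        where
        expand : ∀ s x → x * (s + + 6 * x) ≡ x * s + + 6 * (x * x)
        expand = solve-∀

      a : Fin (suc k) → ℤ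
      a i = + 6 * lookup y i

      total : sumSquares a ≡ + 6 * (Q + (b * b + c * c))
      total = begin
        sum (λ i → a i * a i)
          ≡⟨ sum-cong-≗ (λ i → expand (lookup y i)) ⟩
        sum (λ i → + 36 * (lookup y i * lookup y i))
          ≡⟨ *-distribˡ-sum (+ 36) (λ i → lookup y i * lookup y i) ⟨
        + 36 * sumSquares (lookup y)
          ≡⟨ *-assoc (+ 6) (+ 6) (sumSquares (lookup y)) ⟩
        -- One of the two factors 6 is absorbed by the norm of `T`, which passes from `y` to `x`,
        -- `b` and `c`.
        + 6 * (+ 6 * sumSquares (lookup y))
          ≡⟨ cong (+ 6 *_) (T-norm y) ⟨
        + 6 * sumSquares (lookup (T y))
          ≡⟨ cong (+ 6 *_) (sum-↑ l (λ i → lookup (T y) i * lookup (T y) i)) ⟩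
        + 6 * (Q + (b * b + c * c)) ∎
        where
        expand : ∀ z → (+ 6 * z) * (+ 6 * z) ≡ + 36 * (z * z)
        expand = solve-∀

      split : sumSquares a ≡ (s * s + + 6 * Q) + a (fromℕ k) * a (fromℕ k)
      split = begin
        sumSquares a
          ≡⟨ sum-init-last (λ i → a i * a i) ⟩
        sum (λ i → a (inject₁ i) * a (inject₁ i)) + a (fromℕ k) * a (fromℕ k)
          ≡⟨ cong (_+ a (fromℕ k) * a (fromℕ k)) (trans (sum-cong-≗ squares) forms) ⟩
        (s * s + + 6 * Q) + a (fromℕ k) * a (fromℕ k) ∎

      -- The two evaluations `split` and `total` share the term 6 `Q`, which cancels.
      balance : a (fromℕ k) * a (fromℕ k) + s * s ≡ + 6 * (b * b + c * c)
      balance = begin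
        a (fromℕ k) * a (fromℕ k) + s * s
          ≡⟨ cancelˡ (a (fromℕ k) * a (fromℕ k)) (s * s) Q ⟩
        ((s * s + + 6 * Q) + a (fromℕ k) * a (fromℕ k)) - + 6 * Q
          ≡⟨ cong (_- + 6 * Q) (trans (sym split) total) ⟩
        + 6 * (Q + (b * b + c * c)) - + 6 * Q
          ≡⟨ cancelʳ Q (b * b + c * c) ⟩
        + 6 * (b * b + c * c) ∎
        where
        cancelˡ : ∀ a s q → a + s ≡ ((s + + 6 * q) + a) - + 6 * q
        cancelˡ = solve-∀
        cancelʳ : ∀ q r → + 6 * (q + r) - + 6 * q ≡ + 6 * r
        cancelʳ = solve-∀

  -- Affine lines with their points at infinity.

  ∣p++q∣ : ∀ {m n} (p : Subset m) (q : Subset n) → ∣ p ++ q ∣ₛ ≡ ∣ p ∣ₛ ℕ.+ ∣ q ∣ₛ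
  ∣p++q∣ []            q = refl
  ∣p++q∣ (inside  ∷ p) q = cong suc (∣p++q∣ p q)
  ∣p++q∣ (outside ∷ p) q = ∣p++q∣ p q

  Empty⇒∣p∣≡0 : ∀ {n} {p : Subset n} → Empty p → ∣ p ∣ₛ ≡ 0
  Empty⇒∣p∣≡0 {n} empty = trans (cong ∣_∣ₛ (Empty-unique empty)) (∣⊥∣≡0 n)

  module ProjectiveLines {n} (𝒜 : AffinePlane n) where
    open AffinePlane 𝒜

    -- The line at infinity is left out: for order 6 the remaining 42 lines and two further unknowns
    -- make 44, one more than the number of points.
    extended : Fin (suc n) × Fin n → Subset (#points n)
    extended (i , k) = line i k ++ ⁅ i ⁆

    ∣extended∩extended∣ : ∀ i k j l → ∣ extended (i , k) ∩ₛ extended (j , l) ∣ₛ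
                            ≡ ∣ line i k ∩ₛ line j l ∣ₛ ℕ.+ ∣ ⁅ i ⁆ ∩ₛ ⁅ j ⁆ ∣ₛ
    ∣extended∩extended∣ i k j l = trans
      (cong ∣_∣ₛ (zipWith-++ _∧_ (line i k) ⁅ i ⁆ (line j l) ⁅ j ⁆))
      (∣p++q∣ (line i k ∩ₛ line j l) (⁅ i ⁆ ∩ₛ ⁅ j ⁆))

    ∣⁅x⁆∩⁅x⁆∣≡1 : ∀ i → ∣ ⁅ i ⁆ ∩ₛ ⁅ i ⁆ ∣ₛ ≡ 1
    ∣⁅x⁆∩⁅x⁆∣≡1 i = trans (cong ∣_∣ₛ (∩-idem ⁅ i ⁆)) (∣⁅x⁆∣≡1 {suc n} i)

    extended-size : ∀ ik → ∣ extended ik ∩ₛ extended ik ∣ₛ ≡ n ℕ.+ 1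
    extended-size (i , k) = trans (∣extended∩extended∣ i k i k)
      (cong₂ ℕ._+_ (trans (cong ∣_∣ₛ (∩-idem (line i k))) (size i k)) (∣⁅x⁆∩⁅x⁆∣≡1 i))

    -- Parallel lines share only their point at infinity, all other pairs only their affine
    -- intersection.
    extended-meet : ∀ {ik jl} → ik ≢ jl → ∣ extended ik ∩ₛ extended jl ∣ₛ ≡ 1
    extended-meet {i , k} {j , l} ik≢jl with i ≟ j
    ... | yes refl = trans (∣extended∩extended∣ i k i l)
      (cong₂ ℕ._+_ (Empty⇒∣p∣≡0 (disjoint i λ { refl → ik≢jl refl })) (∣⁅x⁆∩⁅x⁆∣≡1 i))
    ... | no i≢j = trans (∣extended∩extended∣ i k j l)
      (cong₂ ℕ._+_ (meet i≢j k l) (Empty⇒∣p∣≡0 λ (x , x∈) →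
        let x∈i , x∈j = x∈p∩q⁻ ⁅ i ⁆ ⁅ j ⁆ x∈
        in  i≢j (trans (sym (x∈⁅y⁆⇒x≡y i x∈i)) (x∈⁅y⁆⇒x≡y j x∈j))))

    indexed : Fin (suc n ℕ.* n) → Subset (#points n)
    indexed = extended ∘ remQuot n

    indexed-meet : ∀ {i j} → i ≢ j → ∣ indexed i ∩ₛ indexed j ∣ₛ ≡ 1
    indexed-meet {i} {j} i≢j = extended-meet λ e → i≢j (trans (sym (combine-remQuot {suc n} n i))
      (trans (cong (uncurry combine) e) (combine-remQuot {suc n} n j)))

  ¬AffinePlane6 : ¬ AffinePlane 6
  -- The dimensions agree by computation: 43 points and one more, or 7 · 6 lines and two more, both
  -- give 11 · 4.
  ¬AffinePlane6 𝒜 = no-rotated-family indexed (extended-size ∘ remQuot 6) indexed-meet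
                      (rotate 11) (rotate-isLinearMap 11) (sumSquares-rotate 11)
    where open ProjectiveLines 𝒜

-- Classification of nets of order 7: forward-checking search.

module Nets where
  open import Data.Bool.ListAction using (all; any)
  open import Data.Bool.Properties using (T-∧; T-≡)
  open import Data.List.Base
    using (List; []; _∷_; _++_; map; concatMap; filterᵇ; upTo; tabulate; allFin; cartesianProduct)
  open import Data.List.Membership.Propositional using (_∈_; find; lose)
  open import Data.List.Membership.Propositional.Properties
    using (∈-filter⁺; ∈-filter⁻; ∈-map⁺; ∈-map⁻; ∈-concatMap⁺; ∈-concatMap⁻; ∈-upTo⁺; ∈-upTo⁻;
           ∈-allFin; ∈-cartesianProduct⁺)
  open import Data.List.Properties using (map-∘; map-id; tabulate-cong)
  open import Data.List.Relation.Binary.Permutation.Propositional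
    using (_↭_; ↭-refl; ↭-trans; prep; swap; ↭⇒↭ₛ)
  import Data.List.Relation.Binary.Permutation.Propositional.Properties as ↭
  import Data.List.Relation.Binary.Permutation.Setoid.Properties as ↭ₛ
  open import Data.List.Relation.Unary.All as All using (All; []; _∷_)
  import Data.List.Relation.Unary.All.Properties as All
  open import Data.List.Relation.Unary.AllPairs using ([]; _∷_)
  open import Data.List.Relation.Unary.Any using (here)
  import Data.List.Relation.Unary.Any.Properties as Any
  open import Data.List.Relation.Unary.Unique.Propositional using (Unique)
  open import Data.List.Relation.Unary.Unique.Propositional.Properties using (allFin⁺; cartesianProduct⁺)
  open import Data.Nat.Base using (_+_; _*_; _%_; _≡ᵇ_)
  open import Data.Nat.Properties using (≡ᵇ⇒≡; ≡⇒≡ᵇ)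
  open ≡-Reasoning

  module ForwardChecking {V A : Set} (compatible : V → A → V → A → Bool)
                         (accept : List (V × A) → Bool) where

    Domain : Set
    Domain = V × List A

    shorter : List A → List A → Bool
    shorter []       _        = true
    shorter (_ ∷ _)  []       = false
    shorter (_ ∷ as) (_ ∷ bs) = shorter as bs

    -- Branching on a domain with the fewest remaining candidates keeps the search tree small.
    -- Correctness needs only that the domains are permuted, which is `pull-↭`.
    pull : Domain → List Domain → List Domain → Domain × List Domain
    pull d seen []       = d , seen
    pull d seen (e ∷ ds) =
      if shorter (proj₂ d) (proj₂ e) then pull d (e ∷ seen) ds else pull e (d ∷ seen) ds

    prune : V → A → List Domain → List Domain
    prune v a = map λ (w , bs) → w , filterᵇ (compatible v a w) bs

    mutual
      -- The first argument is fuel. Running out of it yields `false`, so the answer `true`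
      -- certifies a complete search. A dead end with an empty domain counts as success, since no
      -- solution passes through it.
      search : ℕ → List (V × A) → List Domain → Bool
      search zero    chosen _        = false
      search (suc n) chosen []       = accept chosen
      search (suc n) chosen (d ∷ ds) = branch n chosen (pull d [] ds)

      branch : ℕ → List (V × A) → Domain × List Domain → Bool
      branch n chosen ((v , as) , ds) = all (λ a → search n ((v , a) ∷ chosen) (prune v a ds)) as

    -- Opaque, since comparing two stuck searches would unfold every branch of both.
    opaque
      solve : ℕ → (V → List A) → List V → Bool
      solve n options vs = search n [] (map (λ v → v , options v) vs)

    pull-↭ : ∀ d seen ds → let e , es = pull d seen ds in d ∷ seen ++ ds ↭ e ∷ es
    pull-↭ d seen []       = prep d (↭.++-comm seen [])
    pull-↭ d seen (e ∷ ds) with shorter (proj₂ d) (proj₂ e)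
    ... | true  = ↭-trans (prep d (↭.shift e seen ds)) (pull-↭ d (e ∷ seen) ds)
    ... | false = ↭-trans (prep d (↭.shift e seen ds)) $
                  ↭-trans (swap d e ↭-refl) (pull-↭ e (d ∷ seen) ds)

    variables : List Domain → List V
    variables = map proj₁

    prune-variables : ∀ v a ds → variables (prune v a ds) ≡ variables ds
    prune-variables v a ds = sym (map-∘ ds)

    module _ (solution : V → A)
             (consistent : ∀ {v w} → v ≢ w → T (compatible v (solution v) w (solution w))) where

      Contains : Domain → Set
      Contains (v , as) = solution v ∈ as

      Unique-resp-↭ : ∀ {vs ws : List V} → vs ↭ ws → Unique vs → Unique ws
      Unique-resp-↭ p = ↭ₛ.Unique-resp-↭ (setoid V) (↭⇒↭ₛ p)

      prune-contains : ∀ {v} ds → All (v ≢_) (variables ds) → All Contains ds →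
                       All Contains (prune v (solution v) ds)
      prune-contains []       _          _          = []
      prune-contains {v} ((w , _) ∷ ds) (v≢w ∷ v≢) (s ∷ ss) =
        ∈-filter⁺ (T? ∘ compatible v (solution v) w) s (consistent v≢w) ∷ prune-contains ds v≢ ss

      assigned : V → V × A
      assigned v = v , solution v

      mutual
        -- The solution traces one branch of the tree: being consistent, its values survive every
        -- pruning, so the leaf of that branch has been accepted. The leaf lists the assignments in
        -- the order of branching, hence only up to permutation.
        search-sound : ∀ n chosen ds → Unique (variables ds) → All Contains ds → T (search n chosen ds) →
                       ∃[ full ] T (accept full) × chosen ++ map assigned (variables ds) ↭ full
        search-sound (suc n) chosen []       _ _  t = chosen , t , ↭.++-comm chosen []
        search-sound (suc n) chosen (d ∷ ds) u cs t =
          let full , acc , p = branch-sound n chosen (pull d [] ds)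
                                 (Unique-resp-↭ (↭.map⁺ proj₁ q) u) (↭.All-resp-↭ q cs) t
          in  full , acc , ↭-trans (↭.++⁺ˡ chosen (↭.map⁺ assigned (↭.map⁺ proj₁ q))) p
          where q = pull-↭ d [] ds

        branch-sound : ∀ n chosen p → let (v , as) , ds = p in
                       Unique (v ∷ variables ds) → All Contains ((v , as) ∷ ds) → T (branch n chosen p) →
                       ∃[ full ] T (accept full) × chosen ++ map assigned (v ∷ variables ds) ↭ full
        branch-sound n chosen ((v , as) , ds) (v≢ ∷ u) (c ∷ cs) t =
          let full , acc , p = search-sound n ((v , a) ∷ chosen) (prune v a ds)
                                 (subst Unique (sym vars) u) (prune-contains ds v≢ cs)
                                 (All.lookup (All.all⁺ _ as t) c)
          in  full , acc ,
              ↭-trans (↭.shift (v , a) chosen _)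
                      (subst (λ vs → (v , a) ∷ chosen ++ map assigned vs ↭ full) vars p)
          where
          a = solution v
          vars = prune-variables v a ds

      opaque
        unfolding solve

        solve-sound : ∀ n options vs → Unique vs → (∀ v → solution v ∈ options v) →
                      solve n options vs ≡ true →
                      ∃[ full ] T (accept full) × (∀ {v} → v ∈ vs → (v , solution v) ∈ full)
        solve-sound n options vs u sol t =
          let full , acc , p = search-sound n [] ds (subst Unique (sym vars) u)
                                 (All.map⁺ (All.universal sol vs)) (Equivalence.from T-≡ t)
          in  full , acc , λ v∈ →
                ↭.∈-resp-↭ (subst (λ vs → map assigned vs ↭ full) vars p) (∈-map⁺ assigned v∈)
          where
          ds : List Domain
          ds = map (λ v → v , options v) vs
          vars : variables ds ≡ vs
          vars = trans (sym (map-∘ vs)) (map-id vs)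

  -- Permutations as words, and the finite checks on them.

  Word : Set
  Word = List ℕ

  -- Lines are graphs of permutations: parallel ones agree `never`, those of different classes
  -- exactly `once`.
  never once : Word → Word → Bool
  never (x ∷ xs) (y ∷ ys) = if x ≡ᵇ y then false else never xs ys
  never _        _        = true
  once (x ∷ xs) (y ∷ ys) = if x ≡ᵇ y then never xs ys else once xs ys
  once _        _        = false

  startsWith : Word → Word → Bool
  startsWith []       _        = true
  startsWith (_ ∷ _)  []       = false
  startsWith (x ∷ xs) (y ∷ ys) = if x ≡ᵇ y then startsWith xs ys else false

  at : Word → ℕ → ℕ
  at []       _       = 0
  at (x ∷ _)  zero    = x
  at (_ ∷ xs) (suc n) = at xs n

  extend : ℕ → Word → List Word
  extend n w = map (_∷ w) (filterᵇ (λ y → not (any (y ≡ᵇ_) w)) (upTo n))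

  injections : ℕ → ℕ → List Word
  injections zero    n = [] ∷ []
  injections (suc k) n = concatMap (extend n) (injections k n)

  -- The derangements of 1, …, 6, extended by 0 ↦ 0, have the cycle types 6, 4 + 2,
  -- 3 + 3 and 2 + 2 + 2.
  normalForms : List Word
  normalForms
    = (0 ∷ 2 ∷ 3 ∷ 4 ∷ 5 ∷ 6 ∷ 1 ∷ [])
    ∷ (0 ∷ 2 ∷ 3 ∷ 4 ∷ 1 ∷ 6 ∷ 5 ∷ [])
    ∷ (0 ∷ 2 ∷ 3 ∷ 1 ∷ 5 ∷ 6 ∷ 4 ∷ [])
    ∷ (0 ∷ 2 ∷ 1 ∷ 4 ∷ 3 ∷ 6 ∷ 5 ∷ [])
    ∷ []

  fixedPointFree : Word → Bool
  fixedPointFree w = startsWith (0 ∷ []) w ∧ once w (upTo 7)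

  pointwise : (ℕ → ℕ → Bool) → Word → Word → Bool
  pointwise p (x ∷ xs) (y ∷ ys) = p x y ∧ pointwise p xs ys
  pointwise p _        _        = true

  -- With a = α x and y = f x this tests α (f x) = g (α x), that is α f α⁻¹ = g, without forming an
  -- inverse.
  intertwines : Word → Word → ℕ → ℕ → Bool
  intertwines α g a y = at α y ≡ᵇ at g a

  conjugates : Word → Word → Word → Bool
  conjugates f α g = pointwise (intertwines α g) α f

  normalizable : List Word → Word → Bool
  normalizable αs f = any (λ α → any (conjugates f α) normalForms) αs

  allNormalizable : List Word → Bool
  allNormalizable ws = all (normalizable (filterᵇ (startsWith (0 ∷ [])) ws)) (filterᵇ fixedPointFree ws)

  Var : Set
  Var = Fin 6 × Fin 7

  variables₀ : List Var
  variables₀ = cartesianProduct (allFin 6) (allFin 7)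

  compatible : Var → Word → Var → Word → Bool
  compatible (c , _) xs (d , _) = if toℕ c ≡ᵇ toℕ d then never xs else once xs

  -- The initial domains express the conditions in `Normal`. The normal forms send 1 to 2 already,
  -- as the slope of class 1 requires.
  candidates : List Word → Var → List Word
  candidates ws (c           , suc b) = filterᵇ (startsWith (suc (toℕ b) ∷ [])) ws
  candidates ws (zero        , zero)  = upTo 7 ∷ []
  candidates ws (suc zero    , zero)  = normalForms
  -- This class has number c + 2 and therefore slope c + 3.
  candidates ws (suc (suc c) , zero)  = filterᵇ (startsWith (0 ∷ 3 + toℕ c ∷ [])) ws

  -- The slope of class c is its value c + 1 at 1, so α is to carry y = σ c b x to
  -- α y = α (c + 1) · α x + α b; here a is α x.
  collinear : Word → Fin 6 → Fin 7 → ℕ → ℕ → Bool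
  collinear α c b a y = at α y ≡ᵇ (at α (suc (toℕ c)) * a + at α (toℕ b)) % 7

  linearised : Word → Var × Word → Bool
  linearised α ((c , b) , w) = pointwise (collinear α c b) α w

  linearisable : List Word → List (Var × Word) → Bool
  linearisable αs lines = any (λ α → all (linearised α) lines) αs

  -- The fuel 43 allows one step for each of the 42 variables and one to accept.
  allLinearisable : List Word → Bool
  allLinearisable ws =
    -- Only α with α 0 = 0 and α 1 = 1 can succeed, because the identity σ 0 0 must satisfy α x = α
    -- 1 · α x + α 0.
    ForwardChecking.solve compatible (linearisable (filterᵇ (startsWith (0 ∷ 1 ∷ [])) ws))
      43 (candidates ws) variables₀

  -- Correctness of the checks on words.

  T-not : ∀ b → ¬ T b → T (not b)
  T-not true  ¬t = ¬t tt
  T-not false _  = tt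

  T-not⁻ : ∀ b → T (not b) → ¬ T b
  T-not⁻ false _ ()

  ≡ᵇ-refl : ∀ m → (m ≡ᵇ m) ≡ true
  ≡ᵇ-refl m = Equivalence.to T-≡ (≡⇒≡ᵇ m m refl)

  word : ∀ {k n} → (Fin k → Fin n) → Word
  word f = tabulate (toℕ ∘ f)

  private variable
    k n : ℕ

  never-tabulate : ∀ {f g : Fin k → ℕ} → (∀ i → f i ≢ g i) → T (never (tabulate f) (tabulate g))
  never-tabulate {k = zero}              _  = tt
  never-tabulate {k = suc k} {f} {g} f≢g with f zero ≡ᵇ g zero in eq
  ... | true  = f≢g zero (≡ᵇ⇒≡ _ _ (subst T (sym eq) tt))
  ... | false = never-tabulate (f≢g ∘ suc)

  once-tabulate : ∀ {f g : Fin k → ℕ} i → f i ≡ g i → (∀ j → f j ≡ g j → j ≡ i) →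
                  T (once (tabulate f) (tabulate g))
  once-tabulate {k = suc k} {f} {g} i e unique with f zero ≡ᵇ g zero in eq
  ... | true  = never-tabulate λ j e′ → 0≢1+n (trans (unique zero (≡ᵇ⇒≡ _ _ (subst T (sym eq) tt)))
                                                     (sym (unique (suc j) e′)))
  once-tabulate zero    e unique | false = contradiction (≡⇒≡ᵇ _ _ e) (subst T eq)
  once-tabulate (suc i) e unique | false = once-tabulate i e λ j e′ → suc-injective (unique (suc j) e′)

  pointwise-tabulate : ∀ p {f g : Fin k → ℕ} → T (pointwise p (tabulate f) (tabulate g)) →
                       ∀ i → T (p (f i) (g i))
  pointwise-tabulate p t zero    = proj₁ (Equivalence.to T-∧ t)
  pointwise-tabulate p {f} {g} t (suc i) =
    pointwise-tabulate p (proj₂ (Equivalence.to (T-∧ {p (f zero) (g zero)}) t)) i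

  at-tabulate : ∀ (f : Fin k → ℕ) i → at (tabulate f) (toℕ i) ≡ f i
  at-tabulate f zero    = refl
  at-tabulate f (suc i) = at-tabulate (f ∘ suc) i

  word∈injections : (f : Fin k → Fin n) → Injective _≡_ _≡_ f → word f ∈ injections k n
  word∈injections {zero}      f inj = here refl
  word∈injections {suc k} {n} f inj = ∈-concatMap⁺ (extend n)
    (lose (word∈injections (f ∘ suc) (suc-injective ∘ inj))
      (∈-map⁺ (_∷ word (f ∘ suc))
        (∈-filter⁺ (T? ∘ _) (∈-upTo⁺ (toℕ<n (f zero)))
          (T-not _ (fresh ∘ Any.tabulate⁻ ∘ Any.any⁻ (toℕ (f zero) ≡ᵇ_) (word (f ∘ suc)))))))
    where
    fresh : ¬ (∃[ i ] T (toℕ (f zero) ≡ᵇ toℕ (f (suc i))))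
    fresh (i , e) = 0≢1+n (inj (toℕ-injective (≡ᵇ⇒≡ _ _ e)))

  injections⇒word : ∀ k n {w} → w ∈ injections k n →
                    ∃[ f ] Injective _≡_ _≡_ f × w ≡ word {k} {n} f
  injections⇒word zero    n (here refl) = (λ ()) , (λ { {()} }) , refl
  injections⇒word (suc k) n w∈
    with v , v∈ , w∈′ ← find (∈-concatMap⁻ (extend n) {xs = injections k n} w∈)
    with f , f-inj , refl ← injections⇒word k n v∈
    with y , y∈ , refl ← ∈-map⁻ (_∷ word f) w∈′
    with y∈′ , t ← ∈-filter⁻ (T? ∘ _) {xs = upTo n} y∈
    = g , g-inj , cong (_∷ word f) (sym (toℕ-fromℕ< y<n))
    where
    y<n = ∈-upTo⁻ y∈′
    g : Fin (suc k) → Fin n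
    g zero    = fromℕ< y<n
    g (suc i) = f i

    fresh : ∀ {i} → fromℕ< y<n ≢ f i
    fresh {i} e = T-not⁻ _ t (Any.any⁺ (y ≡ᵇ_) (Any.tabulate⁺ i (≡⇒≡ᵇ y _
      (trans (sym (toℕ-fromℕ< y<n)) (cong toℕ e)))))

    g-inj : Injective _≡_ _≡_ g
    g-inj {zero}  {zero}  e = refl
    g-inj {zero}  {suc j} e = contradiction e fresh
    g-inj {suc i} {zero}  e = contradiction (sym e) fresh
    g-inj {suc i} {suc j} e = cong suc (f-inj e)

  -- The b-th line of the c-th class is the graph y = σ c b x.
  record Net (r n : ℕ) : Set where
    field
      σ            : Fin r → Fin n → Fin n → Fin n
      σ-injˡ       : ∀ {c b b′ x} → σ c b x ≡ σ c b′ x → b ≡ b′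
      σ-injʳ       : ∀ {c b x x′} → σ c b x ≡ σ c b x′ → x ≡ x′
      cross        : ∀ {c d} → c ≢ d → ∀ b b′ → ∃[ x ] σ c b x ≡ σ d b′ x
      cross-unique : ∀ {c d b b′ x x′} → c ≢ d → σ c b x ≡ σ d b′ x → σ c b x′ ≡ σ d b′ x′ → x ≡ x′

  open Net

  -- Relabelling of nets.

  infix 4 _∼_

  -- An isotopy: `α` relabels abscissas, `β` ordinates, `γ` classes, and `δ c` the lines within
  -- class c.
  record _∼_ {r n} (M N : Net r n) : Set where
    field
      α β : Permutation′ n
      γ   : Permutation′ r
      δ   : Fin r → Permutation′ n
      law : ∀ c b x → β ⟨$⟩ʳ σ M c b x ≡ σ N (γ ⟨$⟩ʳ c) (δ c ⟨$⟩ʳ b) (α ⟨$⟩ʳ x)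

  ∼-trans : ∀ {r n} {L M N : Net r n} → L ∼ M → M ∼ N → L ∼ N
  ∼-trans p q = record
    { α   = P.α ∘ₚ Q.α
    ; β   = P.β ∘ₚ Q.β
    ; γ   = P.γ ∘ₚ Q.γ
    ; δ   = λ c → P.δ c ∘ₚ Q.δ (P.γ ⟨$⟩ʳ c)
    ; law = λ c b x → trans (cong (Q.β ⟨$⟩ʳ_) (P.law c b x)) (Q.law _ _ _)
    }
    where module P = _∼_ p
          module Q = _∼_ q

  module Relabelling {r n} (N : Net r n) (α β : Permutation′ n) (γ : Permutation′ r)
                     (δ : Fin r → Permutation′ n) where

    σ′ : Fin r → Fin n → Fin n → Fin n
    σ′ c b x = β ⟨$⟩ʳ σ N (γ ⟨$⟩ˡ c) (δ (γ ⟨$⟩ˡ c) ⟨$⟩ˡ b) (α ⟨$⟩ˡ x)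

    β-inj : Injective _≡_ _≡_ (β ⟨$⟩ʳ_)
    β-inj = permutation-injective β

    flip-inj : ∀ {m} (π : Permutation′ m) → Injective _≡_ _≡_ (π ⟨$⟩ˡ_)
    flip-inj π = permutation-injective (flip π)

    net : Net r n
    net = record
      { σ            = σ′
      ; σ-injˡ       = λ e → flip-inj (δ _) (σ-injˡ N (β-inj e))
      ; σ-injʳ       = λ e → flip-inj α (σ-injʳ N (β-inj e))
      ; cross        = λ c≢d b b′ →
          let x , e = cross N (c≢d ∘ flip-inj γ) (δ _ ⟨$⟩ˡ b) (δ _ ⟨$⟩ˡ b′)
          in  α ⟨$⟩ʳ x , cong (β ⟨$⟩ʳ_) (subst (λ x → σ N _ _ x ≡ σ N _ _ x) (sym (inverseˡ α)) e)
      ; cross-unique = λ c≢d e e′ →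
          flip-inj α (cross-unique N (c≢d ∘ flip-inj γ) (β-inj e) (β-inj e′))
      }

    relabelled : N ∼ net
    relabelled = record { α = α ; β = β ; γ = γ ; δ = δ ; law = law }
      where
      law : ∀ c b x → β ⟨$⟩ʳ σ N c b x ≡ σ′ (γ ⟨$⟩ʳ c) (δ c ⟨$⟩ʳ b) (α ⟨$⟩ʳ x)
      law c b x rewrite inverseˡ γ {c} | inverseˡ (δ c) {b} | inverseˡ α {x} = refl

  -- Separates the properties of the list of permutations from the list itself, so that the
  -- arguments below never evaluate it.
  record Enumerates (ws : List Word) : Set where
    field
      complete : (f : Fin 7 → Fin 7) → Injective _≡_ _≡_ f → word f ∈ ws
      sound    : ∀ {w} → w ∈ ws → ∃[ f ] Injective _≡_ _≡_ f × w ≡ word {7} {7} f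

  startsWith-word : ∀ {f : Fin (suc k) → Fin n} {y} → toℕ (f 0F) ≡ y → T (startsWith (y ∷ []) (word f))
  startsWith-word {y = y} refl rewrite ≡ᵇ-refl y = tt

  startsWith-word⁻ : ∀ (f : Fin (suc k) → Fin n) {y ys} → T (startsWith (y ∷ ys) (word f)) → y ≡ toℕ (f 0F)
  startsWith-word⁻ f {y} t with y ≡ᵇ toℕ (f 0F) in eq
  ... | true = ≡ᵇ⇒≡ _ _ (subst T (sym eq) tt)

  module _ {ws} (enum : Enumerates ws) where
    open Enumerates enum

    startingWith : ∀ {ys w} → w ∈ filterᵇ (startsWith (0 ∷ ys)) ws →
                   Σ[ ρ ∈ Permutation′ 7 ] ρ ⟨$⟩ʳ 0F ≡ 0F × w ≡ word (ρ ⟨$⟩ʳ_)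
    startingWith {ys} w∈
      with w∈ws , t ← ∈-filter⁻ (T? ∘ startsWith (0 ∷ ys)) {xs = ws} w∈
      with f , inj , refl ← sound w∈ws
      = injective⇒permutation f inj , toℕ-injective (sym (startsWith-word⁻ f {ys = ys} t)) , refl

    conjugate-normalForm :
      allNormalizable ws ≡ true →
      (f : Fin 7 → Fin 7) → Injective _≡_ _≡_ f → f 0F ≡ 0F → (∀ x → f x ≡ x → x ≡ 0F) →
      Σ[ ρ ∈ Permutation′ 7 ] ρ ⟨$⟩ʳ 0F ≡ 0F ×
        ∃[ g ] g ∈ normalForms × ∀ x → toℕ (ρ ⟨$⟩ʳ f x) ≡ at g (toℕ (ρ ⟨$⟩ʳ x))
    conjugate-normalForm check f inj f0 fpf
      with α , α∈ , t ← find (Any.any⁻ (λ α → any (conjugates (word f) α) normalForms) _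
             (All.lookup (All.all⁺ _ _ (Equivalence.from T-≡ check)) (∈-filter⁺ (T? ∘ fixedPointFree)
               (complete f inj)
               (Equivalence.from T-∧ (startsWith-word {f = f} (cong toℕ f0) ,
                  once-tabulate {f = toℕ ∘ f} {g = toℕ} 0F (cong toℕ f0) λ x e → fpf x (toℕ-injective e))))))
      with ρ , ρ0 , refl ← startingWith α∈
      with g , g∈ , t′ ← find (Any.any⁻ (conjugates (word f) (word (ρ ⟨$⟩ʳ_))) normalForms t)
      = ρ , ρ0 , g , g∈ , λ x →
          trans (sym (at-tabulate (λ x → toℕ (ρ ⟨$⟩ʳ x)) (f x)))
                (≡ᵇ⇒≡ _ _ (pointwise-tabulate (intertwines (word (ρ ⟨$⟩ʳ_)) g)
                  {f = λ x → toℕ (ρ ⟨$⟩ʳ x)} {g = λ x → toℕ (f x)} t′ x))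

  -- Linearisation of normalised nets.

  record Normal (N : Net 6 7) : Set where
    field
      base   : ∀ c b → σ N c b 0F ≡ b
      unit   : ∀ x → σ N 0F 0F x ≡ x
      double : word (σ N 1F 0F) ∈ normalForms
      slope  : ∀ c → σ N c 0F 1F ≡ suc c

  module Linearisation {ws} (enum : Enumerates ws) (check : allLinearisable ws ≡ true)
                       (N : Net 6 7) (normal : Normal N) where
    open Enumerates enum
    open Normal normal

    solution : Var → Word
    solution (c , b) = word (σ N c b)

    consistent : ∀ {v w} → v ≢ w → T (compatible v (solution v) w (solution w))
    consistent {c , b} {d , b′} v≢w with c ≟ d
    ... | yes refl rewrite ≡ᵇ-refl (toℕ c) =
      never-tabulate {f = toℕ ∘ σ N c b} {g = toℕ ∘ σ N c b′} λ x e →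
        v≢w (cong (c ,_) (σ-injˡ N (toℕ-injective e)))
    ... | no c≢d with toℕ c ≡ᵇ toℕ d in eq
    ...   | true  = contradiction (toℕ-injective (≡ᵇ⇒≡ _ _ (subst T (sym eq) tt))) c≢d
    ...   | false = let x , e = cross N c≢d b b′ in
      once-tabulate x (cong toℕ e) λ _ e′ → cross-unique N c≢d (toℕ-injective e′) e

    solution∈candidates : ∀ v → solution v ∈ candidates ws v
    solution∈candidates (c , suc b) = ∈-filter⁺ (T? ∘ _) (complete _ (σ-injʳ N))
      (startsWith-word {f = σ N c (suc b)} (cong toℕ (base c (suc b))))
    solution∈candidates (zero , zero) = here (tabulate-cong (cong toℕ ∘ unit))
    solution∈candidates (suc zero , zero) = double
    solution∈candidates (suc (suc c) , zero) = ∈-filter⁺ (T? ∘ _) (complete _ (σ-injʳ N)) starts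
      where
      starts : T (startsWith (0 ∷ 3 + toℕ c ∷ []) (word (σ N (suc (suc c)) 0F)))
      starts rewrite base (suc (suc c)) 0F | slope (suc (suc c)) | ≡ᵇ-refl (toℕ c) = tt

    accepts : List (Var × Word) → Bool
    accepts = linearisable (filterᵇ (startsWith (0 ∷ 1 ∷ [])) ws)

    -- The net itself solves the constraints, so the leaf it leads to was accepted, and the α found
    -- there straightens all 42 lines at once.
    linearise : Σ[ ρ ∈ Permutation′ 7 ] ρ ⟨$⟩ʳ 0F ≡ 0F × (∀ c b x → toℕ (ρ ⟨$⟩ʳ σ N c b x)
                  ≡ (toℕ (ρ ⟨$⟩ʳ suc c) * toℕ (ρ ⟨$⟩ʳ x) + toℕ (ρ ⟨$⟩ʳ b)) % 7)
    linearise
      with full , t , covers ← ForwardChecking.solve-sound compatible accepts solution consistent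
             43 (candidates ws) variables₀ (cartesianProduct⁺ (allFin⁺ 6) (allFin⁺ 7))
             solution∈candidates check
      with α , α∈ , t′ ← find (Any.any⁻ (λ α → all (linearised α) full) _ t)
      with ρ , ρ0 , refl ← startingWith enum α∈
      = ρ , ρ0 , linear
      where
      linear : ∀ c b x → toℕ (ρ ⟨$⟩ʳ σ N c b x)
                 ≡ (toℕ (ρ ⟨$⟩ʳ suc c) * toℕ (ρ ⟨$⟩ʳ x) + toℕ (ρ ⟨$⟩ʳ b)) % 7
      linear c b x = begin
        toℕ (ρ ⟨$⟩ʳ σ N c b x)
          ≡⟨ at-tabulate toρ (σ N c b x) ⟨
        at (word (ρ ⟨$⟩ʳ_)) (toℕ (σ N c b x))
          ≡⟨ ≡ᵇ⇒≡ _ _ (pointwise-tabulate (collinear (word (ρ ⟨$⟩ʳ_)) c b) {f = toρ} {g = toℕ ∘ σ N c b}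
               (All.lookup (All.all⁺ _ full t′) (covers (∈-cartesianProduct⁺ (∈-allFin c) (∈-allFin b)))) x) ⟩
        (at (word (ρ ⟨$⟩ʳ_)) (suc (toℕ c)) * toρ x + at (word (ρ ⟨$⟩ʳ_)) (toℕ b)) % 7
          ≡⟨ cong₂ (λ m k → (m * toρ x + k) % 7) (at-tabulate toρ (suc c)) (at-tabulate toρ b) ⟩
        (toρ (suc c) * toρ x + toρ b) % 7 ∎
        where
        toρ : Fin 7 → ℕ
        toρ y = toℕ (ρ ⟨$⟩ʳ y)

  -- Reduction of a net to normal form.

  permutation-fixes : ∀ {n} (π : Permutation′ n) {x y} → π ⟨$⟩ʳ x ≡ y → π ⟨$⟩ˡ y ≡ x
  permutation-fixes π e = trans (cong (π ⟨$⟩ˡ_) (sym e)) (inverseˡ π)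

  record Based {r n} (N : Net (suc r) (suc n)) : Set where
    field
      base : ∀ c b → σ N c b zero ≡ b
      unit : ∀ x → σ N zero zero x ≡ x

  -- Ordinates are relabelled by the inverse of σ 0 0, which turns that line into y = x; then each
  -- line is labelled by its value at 0.
  based : ∀ {r n} (N : Net (suc r) (suc n)) → Σ[ M ∈ Net (suc r) (suc n) ] N ∼ M × Based M
  based {r} {n} N = net , relabelled , record
    { base = λ c b → inverseʳ (δ c)
    ; unit = λ x → trans (cong (λ b → diagonal ⟨$⟩ˡ σ N zero b x)
                               (permutation-fixes (δ zero) {zero} (inverseˡ diagonal)))
                         (inverseˡ diagonal)
    }
    where
    diagonal : Permutation′ (suc n)
    diagonal = injective⇒permutation (σ N zero zero) (σ-injʳ N)

    δ : Fin (suc r) → Permutation′ (suc n)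
    δ c = injective⇒permutation (λ b → diagonal ⟨$⟩ˡ σ N c b zero)
            (λ e → σ-injˡ N (permutation-injective (flip diagonal) e))

    open Relabelling N idₚ (flip diagonal) idₚ δ

  ∈normalForms-properties : ∀ {g} → g ∈ normalForms → tabulate {n = 7} (at g ∘ toℕ) ≡ g × at g 1 ≡ 2
  ∈normalForms-properties = All.lookup
    {P = λ g → tabulate {n = 7} (at g ∘ toℕ) ≡ g × at g 1 ≡ 2} {xs = normalForms}
    ((refl , refl) ∷ (refl , refl) ∷ (refl , refl) ∷ (refl , refl) ∷ [])

  record HasNormalForm (N : Net 6 7) : Set where
    field
      isBased : Based N
      double  : word (σ N 1F 0F) ∈ normalForms

  -- Since σ 1 0 meets the line y = x only at 0, it has 0 as its only fixed point. Relabelling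
  -- abscissas, ordinates and lines by the same ρ conjugates it into a normal form, and ρ 0 = 0
  -- preserves `Based`.
  withNormalForm : ∀ {ws} → Enumerates ws → allNormalizable ws ≡ true →
                   (N : Net 6 7) → Based N → Σ[ M ∈ Net 6 7 ] N ∼ M × HasNormalForm M
  withNormalForm enum check N isBased
    with ρ , ρ0 , g , g∈ , conj ← conjugate-normalForm enum check (σ N 1F 0F) (σ-injʳ N) (Based.base isBased 1F 0F)
           (λ x e → cross-unique N {1F} {0F} {0F} {0F} (λ ()) (trans e (sym (Based.unit isBased x)))
                      (trans (Based.base isBased 1F 0F) (sym (Based.base isBased 0F 0F))))
    = net , relabelled , record
    { isBased = record { base = base′ ; unit = unit′ }
    ; double  = subst (_∈ normalForms) (sym double′) g∈
    }
    where
    open Based isBased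
    open Relabelling N ρ ρ idₚ (λ _ → ρ)

    ρ⁻¹0 : ρ ⟨$⟩ˡ 0F ≡ 0F
    ρ⁻¹0 = permutation-fixes ρ ρ0

    base′ : ∀ c b → σ net c b 0F ≡ b
    base′ c b rewrite ρ⁻¹0 | base c (ρ ⟨$⟩ˡ b) = inverseʳ ρ

    unit′ : ∀ x → σ net 0F 0F x ≡ x
    unit′ x rewrite ρ⁻¹0 | unit (ρ ⟨$⟩ˡ x) = inverseʳ ρ

    double′ : word (σ net 1F 0F) ≡ g
    double′ = trans (tabulate-cong λ x → begin
      toℕ (ρ ⟨$⟩ʳ σ N 1F (ρ ⟨$⟩ˡ 0F) (ρ ⟨$⟩ˡ x))
        ≡⟨ cong (λ b → toℕ (ρ ⟨$⟩ʳ σ N 1F b (ρ ⟨$⟩ˡ x))) ρ⁻¹0 ⟩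
      toℕ (ρ ⟨$⟩ʳ σ N 1F 0F (ρ ⟨$⟩ˡ x))
        ≡⟨ conj (ρ ⟨$⟩ˡ x) ⟩
      at g (toℕ (ρ ⟨$⟩ʳ (ρ ⟨$⟩ˡ x)))
        ≡⟨ cong (at g ∘ toℕ) (inverseʳ ρ) ⟩
      at g (toℕ x) ∎) (proj₁ (∈normalForms-properties g∈))

  -- Classes are renumbered by slope. The values σ c 0 1 are nonzero and distinct, because the lines
  -- σ c 0 already pass through (0, 0). Classes 0 and 1 have slopes 1 and 2 and keep their places.
  normal : (N : Net 6 7) → HasNormalForm N → Σ[ M ∈ Net 6 7 ] N ∼ M × Normal M
  normal N hasNormalForm = net , relabelled , record
    { base   = λ c b → base (γ ⟨$⟩ˡ c) b
    ; unit   = λ x → trans (cong (λ c → σ N c 0F x) (permutation-fixes γ γ0)) (unit x)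
    ; double = subst (λ c → word (σ N c 0F) ∈ normalForms) (sym (permutation-fixes γ γ1)) double
    ; slope  = λ c → trans (sym (suc-γ _)) (cong suc (inverseʳ γ))
    }
    where
    open HasNormalForm hasNormalForm
    open Based isBased

    slope≢0 : ∀ c → 0F ≢ σ N c 0F 1F
    slope≢0 c e = 0≢1+n (σ-injʳ N (trans (base c 0F) e))

    slope-injective : ∀ {c d} → σ N c 0F 1F ≡ σ N d 0F 1F → c ≡ d
    slope-injective {c} {d} e with c ≟ d
    ... | yes c≡d = c≡d
    ... | no  c≢d = contradiction (cross-unique N c≢d (trans (base c 0F) (sym (base d 0F))) e) 0≢1+n

    γ : Permutation′ 6
    γ = injective⇒permutation (λ c → punchOut (slope≢0 c))
          (slope-injective ∘ punchOut-injective (slope≢0 _) (slope≢0 _))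

    suc-γ : ∀ c → suc (γ ⟨$⟩ʳ c) ≡ σ N c 0F 1F
    suc-γ c = punchIn-punchOut (slope≢0 c)

    γ0 : γ ⟨$⟩ʳ 0F ≡ 0F
    γ0 = suc-injective (trans (suc-γ 0F) (unit 1F))

    γ1 : γ ⟨$⟩ʳ 1F ≡ 1F
    γ1 = suc-injective (trans (suc-γ 1F) (toℕ-injective (trans
           (sym (at-tabulate (toℕ ∘ σ N 1F 0F) 1F)) (proj₂ (∈normalForms-properties double)))))

    open Relabelling N idₚ idₚ γ (λ _ → idₚ)

  -- Class c receives the slope `μ` (c + 1). Slope 0, fixed by `μ`, is left for the horizontal
  -- lines, which are not part of the net.
  record Linear (N : Net 6 7) : Set where
    field
      α β μ : Permutation′ 7
      μ0    : μ ⟨$⟩ʳ 0F ≡ 0F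
      δ     : Fin 6 → Permutation′ 7
      law   : ∀ c b x → toℕ (β ⟨$⟩ʳ σ N c b x)
                ≡ (toℕ (μ ⟨$⟩ʳ suc c) * toℕ (α ⟨$⟩ʳ x) + toℕ (δ c ⟨$⟩ʳ b)) % 7

  ∼-linear : ∀ {N M : Net 6 7} → N ∼ M → (ρ : Permutation′ 7) → ρ ⟨$⟩ʳ 0F ≡ 0F →
             (∀ c b x → toℕ (ρ ⟨$⟩ʳ σ M c b x)
                ≡ (toℕ (ρ ⟨$⟩ʳ suc c) * toℕ (ρ ⟨$⟩ʳ x) + toℕ (ρ ⟨$⟩ʳ b)) % 7) →
             Linear N
  ∼-linear N∼M ρ ρ0 linear = record
    { α   = α ∘ₚ ρ
    ; β   = β ∘ₚ ρ
    ; μ   = lift₀ γ ∘ₚ ρ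
    ; μ0  = ρ0
    ; δ   = λ c → δ c ∘ₚ ρ
    ; law = λ c b x → trans (cong (λ y → toℕ (ρ ⟨$⟩ʳ y)) (law c b x))
                            (linear (γ ⟨$⟩ʳ c) (δ c ⟨$⟩ʳ b) (α ⟨$⟩ʳ x))
    }
    where open _∼_ N∼M

  linear : ∀ {ws} → Enumerates ws → allNormalizable ws ≡ true → allLinearisable ws ≡ true →
           (N : Net 6 7) → Linear N
  linear enum normalizable linearisable N =
    let N₁ , N∼N₁ , isBased       = based N
        N₂ , N₁∼N₂ , hasNormalForm = withNormalForm enum normalizable N₁ isBased
        N₃ , N₂∼N₃ , isNormal      = normal N₂ hasNormalForm
        ρ , ρ0 , linear₃           = Linearisation.linearise enum linearisable N₃ isNormal
    in  ∼-linear (∼-trans (∼-trans N∼N₁ N₁∼N₂) N₂∼N₃) ρ ρ0 linear₃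

  -- Evaluation of the finite checks.

  opaque
    -- Opaque, so that the 5040 words are expanded only where a check is evaluated or the
    -- enumeration is proved.
    permutations : List Word
    permutations = injections 7 7

  opaque
    unfolding permutations

    permutations-enumerate : Enumerates permutations
    permutations-enumerate = record
      { complete = word∈injections
      ; sound    = injections⇒word 7 7
      }

    permutations-normalizable : allNormalizable permutations ≡ true
    permutations-normalizable = refl

  opaque
    unfolding permutations ForwardChecking.solve

    permutations-linearisable : allLinearisable permutations ≡ true
    -- The type checker runs the entire search here.
    permutations-linearisable = refl

  opaque
    linearCoordinates : (N : Net 6 7) → Linear N
    linearCoordinates = linear permutations-enumerate permutations-normalizable permutations-linearisable

-- Coordinates on an affine plane.

module Planes where
  open import Data.Bool.Properties using (⇔→≡)
  open import Data.Fin.Subset using (Subset; inside; outside; ⊥; ⊤; ⁅_⁆; ∣_∣; _∩_; _∈_)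
  open import Data.Fin.Subset.Properties
    using (x∈p∩q⁺; x∈p∩q⁻; x∈⁅x⁆; x∈⁅y⁆⇒x≡y; ∩-idem; Empty-unique; ∣⊥∣≡0)
  open import Data.Nat.Base using (_+_; _*_; _%_)
  open import Data.Nat.DivMod using (_mod_; m%n<n; m<n⇒m%n≡m)
  open import Data.Sum.Function.Propositional using (_⊎-↔_)
  open import Data.Vec.Base using (Vec; _∷_; lookup; tabulate; concat; replicate; _++_; here; there)
  open import Data.Vec.Properties
    using (lookup∘tabulate; tabulate∘lookup; tabulate-cong; lookup-splitAt; lookup-replicate; lookup-concat;
           []=⇒lookup; lookup⇒[]=)
  open import Function.Construct.Composition using (_↔-∘_)
  open import Function.Construct.Symmetry using (↔-sym)
  open Nets using (Net; Linear; module Linear; linearCoordinates)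

  ∣p∣≡0⇒∉ : ∀ {n} {p : Subset n} {x} → ∣ p ∣ ≡ 0 → ¬ x ∈ p
  ∣p∣≡0⇒∉ {p = inside  ∷ p} ()
  ∣p∣≡0⇒∉ {p = outside ∷ p} e (there x∈p) = ∣p∣≡0⇒∉ e x∈p

  ∣p∣≡1⇒∃! : ∀ {n} (p : Subset n) → ∣ p ∣ ≡ 1 → ∃[ x ] x ∈ p × (∀ {y} → y ∈ p → y ≡ x)
  ∣p∣≡1⇒∃! (inside  ∷ p) e = zero , here , λ where
    here        → refl
    (there y∈p) → contradiction y∈p (∣p∣≡0⇒∉ (ℕ.suc-injective e))
  ∣p∣≡1⇒∃! (outside ∷ p) e =
    let x , x∈p , unique = ∣p∣≡1⇒∃! p e
    in  suc x , there x∈p , λ { (there y∈p) → cong suc (unique y∈p) }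

  module Coordinates {m} (𝒜 : AffinePlane (suc m)) where
    open AffinePlane 𝒜

    private
      n = suc m

    line-unique : ∀ {i k l p} → p ∈ line i k → p ∈ line i l → k ≡ l
    line-unique {i} {k} {l} p∈k p∈l with k ≟ l
    ... | yes k≡l = k≡l
    ... | no  k≢l = contradiction (_ , x∈p∩q⁺ (p∈k , p∈l)) (disjoint i k≢l)

    meeting : ∀ {i j} → i ≢ j → ∀ k l →
              ∃[ p ] p ∈ line i k ∩ line j l × (∀ {q} → q ∈ line i k ∩ line j l → q ≡ p)
    meeting i≢j k l = ∣p∣≡1⇒∃! _ (meet i≢j k l)

    other : Fin (suc n) → Fin (suc n)
    other zero    = suc zero
    other (suc _) = zero

    other≢ : ∀ i → i ≢ other i
    other≢ zero    ()
    other≢ (suc _) ()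

    grid : Fin (suc n) → Fin n × Fin n → Fin (n * n)
    grid i (k , l) = proj₁ (meeting (other≢ i) k l)

    grid∈ : ∀ i kl → grid i kl ∈ line i (proj₁ kl) × grid i kl ∈ line (other i) (proj₂ kl)
    grid∈ i (k , l) = x∈p∩q⁻ _ _ (proj₁ (proj₂ (meeting (other≢ i) k l)))

    remQuot-injective : ∀ {x y : Fin (n * n)} → remQuot {n} n x ≡ remQuot n y → x ≡ y
    remQuot-injective {x} {y} e =
      trans (sym (combine-remQuot {n} n x)) (trans (cong (uncurry combine) e) (combine-remQuot {n} n y))

    grid-injective : ∀ i → Injective _≡_ _≡_ (grid i ∘ remQuot {n} n)
    grid-injective i {x} {y} e =
      let x∈ , x∈′ = grid∈ i (remQuot n x)
          y∈ , y∈′ = grid∈ i (remQuot n y)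
      in  remQuot-injective (cong₂ _,_
            (line-unique x∈ (subst (_∈ _) (sym e) y∈))
            (line-unique x∈′ (subst (_∈ _) (sym e) y∈′)))

    opaque
      -- No axiom says that a parallel class covers the plane. It does by counting: the n² crossings
      -- with one other class are distinct, hence they are all n² points.
      class : Fin (suc n) → Fin (n * n) → Fin n
      class i p = proj₁ (remQuot n (proj₁ (injective⇒surjective (grid-injective i) p)))

      ∈-class : ∀ i p → p ∈ line i (class i p)
      ∈-class i p = subst (_∈ line i (class i p))
        (proj₂ (injective⇒surjective (grid-injective i) p)) (proj₁ (grid∈ i _))

    class-≡ : ∀ {i k p} → p ∈ line i k → class i p ≡ k
    class-≡ p∈ = line-unique (∈-class _ _) p∈

    ∈-class-≡ : ∀ {i k p} → class i p ≡ k → p ∈ line i k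
    ∈-class-≡ refl = ∈-class _ _

    class-joint-injective : ∀ {i j p q} → i ≢ j → class i p ≡ class i q → class j p ≡ class j q → p ≡ q
    class-joint-injective {i} {j} {p} {q} i≢j eᵢ eⱼ =
      let _ , _ , unique = meeting i≢j (class i q) (class j q)
      in  trans (unique (x∈p∩q⁺ (∈-class-≡ eᵢ , ∈-class-≡ eⱼ)))
                (sym (unique (x∈p∩q⁺ (∈-class i q , ∈-class j q))))

    point : ∀ {i j} → i ≢ j → Fin n → Fin n → Fin (n * n)
    point i≢j k l = proj₁ (meeting i≢j k l)

    class-point : ∀ {i j} (i≢j : i ≢ j) k l → class i (point i≢j k l) ≡ k × class j (point i≢j k l) ≡ l
    class-point i≢j k l =
      let p∈ = x∈p∩q⁻ _ _ (proj₁ (proj₂ (meeting i≢j k l)))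
      in  class-≡ (proj₁ p∈) , class-≡ (proj₂ p∈)

    private
      ∞ : Fin m → Fin (suc n)
      ∞ c = suc (suc c)

      0≢1 : _≢_ {A = Fin (suc n)} zero (suc zero)
      0≢1 ()

      0≢∞ : ∀ {c} → zero ≢ ∞ c
      0≢∞ ()

      ∞-injective : ∀ {c d} → ∞ c ≡ ∞ d → c ≡ d
      ∞-injective refl = refl

      on : Fin m → Fin n → Fin n → Fin (n * n)
      on c b x = point (0≢∞ {c}) x b

      x-on : ∀ c b x → class zero (on c b x) ≡ x
      x-on c b x = proj₁ (class-point 0≢∞ x b)

      class-on : ∀ c b x → class (∞ c) (on c b x) ≡ b
      class-on c b x = proj₂ (class-point 0≢∞ x b)

    -- Classes 0 and 1 give the abscissa and the ordinate of a point; `on c b x` is the point with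
    -- abscissa x on line b of class c + 2.
    ordinate : Fin m → Fin n → Fin n → Fin n
    ordinate c b x = class (suc zero) (on c b x)

    ordinate-class : ∀ c p → ordinate c (class (∞ c) p) (class zero p) ≡ class (suc zero) p
    ordinate-class c p = cong (class (suc zero)) (class-joint-injective 0≢∞ (x-on c _ _) (class-on c _ _))

    private
      on-unique : ∀ {c d b b′ x} → ordinate c b x ≡ ordinate d b′ x → on c b x ≡ on d b′ x
      on-unique {c} {d} {b} {b′} {x} e =
        class-joint-injective 0≢1 (trans (x-on c b x) (sym (x-on d b′ x))) e

    -- Every law comes from two classes determining a point: 0 and 1 for `σ-injˡ`, 1 and `∞ c` for
    -- `σ-injʳ`, `∞ c` and `∞ d` for the two laws on crossings.
    net : Net m n
    net = record
      { σ            = ordinate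
      ; σ-injˡ       = λ {c} {b} {b′} {x} e → begin
          b                             ≡⟨ class-on c b x ⟨
          class (∞ c) (on c b x)        ≡⟨ cong (class (∞ c)) (on-unique e) ⟩
          class (∞ c) (on c b′ x)       ≡⟨ class-on c b′ x ⟩
          b′                            ∎
      ; σ-injʳ       = λ {c} {b} {x} {x′} e → begin
          x                             ≡⟨ x-on c b x ⟨
          class zero (on c b x)         ≡⟨ cong (class zero) (class-joint-injective {suc zero} {∞ c} (λ ()) e
                                             (trans (class-on c b x) (sym (class-on c b x′)))) ⟩
          class zero (on c b x′)        ≡⟨ x-on c b x′ ⟩
          x′                            ∎
      ; cross        = λ {c} {d} c≢d b b′ →
          let p = point (c≢d ∘ ∞-injective) b b′
              p∈c , p∈d = class-point (c≢d ∘ ∞-injective) b b′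
          in  class zero p , (begin
            ordinate c b (class zero p)               ≡⟨ cong (λ b → ordinate c b (class zero p)) p∈c ⟨
            ordinate c (class (∞ c) p) (class zero p) ≡⟨ ordinate-class c p ⟩
            class (suc zero) p                        ≡⟨ ordinate-class d p ⟨
            ordinate d (class (∞ d) p) (class zero p) ≡⟨ cong (λ b → ordinate d b (class zero p)) p∈d ⟩
            ordinate d b′ (class zero p)              ∎)
      ; cross-unique = λ {c} {d} {b} {b′} {x} {x′} c≢d e e′ → begin
          x                             ≡⟨ x-on c b x ⟨
          class zero (on c b x)         ≡⟨ cong (class zero) (class-joint-injective (c≢d ∘ ∞-injective)
                                             (trans (class-on c b x) (sym (class-on c b x′)))
                                             (trans (cong (class (∞ d)) (on-unique e)) (trans (class-on d b′ x)
                                               (trans (sym (class-on d b′ x′))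
                                                 (cong (class (∞ d)) (sym (on-unique e′))))))) ⟩
          class zero (on c b x′)        ≡⟨ x-on c b x′ ⟩
          x′                            ∎
      }
      where open ≡-Reasoning

  -- Isomorphisms of affine planes and of their projective completions.

  open AffinePlane using (line)

  lookup-extensional : ∀ {A : Set} {n} {xs ys : Vec A n} → (∀ i → lookup xs i ≡ lookup ys i) → xs ≡ ys
  lookup-extensional {xs = xs} {ys} e =
    trans (sym (tabulate∘lookup xs)) (trans (tabulate-cong e) (tabulate∘lookup ys))

  lookup-⇔ : ∀ {m n} {S : Subset m} {T : Subset n} {x y} →
             (x ∈ S → y ∈ T) → (y ∈ T → x ∈ S) → lookup S x ≡ lookup T y
  lookup-⇔ {S = S} {T} {x} {y} to from = ⇔→≡ {z = true}
    (mk⇔ ([]=⇒lookup ∘ to ∘ lookup⇒[]= x S) ([]=⇒lookup ∘ from ∘ lookup⇒[]= y T))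

  infixr 5 _⊕_

  _⊕_ : ∀ {m n} → Permutation′ m → Permutation′ n → Permutation′ (m + n)
  _⊕_ π κ = ↔-sym +↔⊎ ↔-∘ ((π ⊎-↔ κ) ↔-∘ +↔⊎)

  image-⊕ : ∀ {m n} (π : Permutation′ m) (κ : Permutation′ n) (S : Subset m) (T : Subset n) →
            image (π ⊕ κ) (S ++ T) ≡ image π S ++ image κ T
  image-⊕ {m} {n} π κ S T = lookup-extensional λ y → begin
    lookup (image (π ⊕ κ) (S ++ T)) y
      ≡⟨ lookup∘tabulate _ y ⟩
    lookup (S ++ T) (join m n (preimage (splitAt m y)))
      ≡⟨ lookup-splitAt m S T _ ⟩
    [ lookup S , lookup T ]′ (splitAt m (join m n (preimage (splitAt m y))))
      ≡⟨ cong [ lookup S , lookup T ]′ (splitAt-join m n (preimage (splitAt m y))) ⟩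
    [ lookup S , lookup T ]′ (preimage (splitAt m y))
      ≡⟨ pointwise (splitAt m y) ⟩
    [ lookup (image π S) , lookup (image κ T) ]′ (splitAt m y)
      ≡⟨ lookup-splitAt m (image π S) (image κ T) y ⟨
    lookup (image π S ++ image κ T) y ∎
    where
    open ≡-Reasoning
    preimage = Sum.map (π ⟨$⟩ˡ_) (κ ⟨$⟩ˡ_)

    pointwise : ∀ y → [ lookup S , lookup T ]′ (preimage y) ≡ [ lookup (image π S) , lookup (image κ T) ]′ y
    pointwise (inj₁ y) = sym (lookup∘tabulate _ y)
    pointwise (inj₂ y) = sym (lookup∘tabulate _ y)

  image-replicate : ∀ {n} (π : Permutation′ n) s → image π (replicate n s) ≡ replicate n s
  image-replicate π s = lookup-extensional λ y →
    trans (lookup∘tabulate _ y) (trans (lookup-replicate (π ⟨$⟩ˡ y) s) (sym (lookup-replicate y s)))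

  image-⁅⁆ : ∀ {n} (π : Permutation′ n) x → image π ⁅ x ⁆ ≡ ⁅ π ⟨$⟩ʳ x ⁆
  image-⁅⁆ π x = lookup-extensional λ y → trans (lookup∘tabulate _ y) (lookup-⇔
    (λ y∈ → subst (_∈ ⁅ π ⟨$⟩ʳ x ⁆) (trans (cong (π ⟨$⟩ʳ_) (sym (x∈⁅y⁆⇒x≡y x y∈))) (inverseʳ π)) (x∈⁅x⁆ _))
    (λ y∈ → subst (_∈ ⁅ x ⁆) (trans (sym (inverseˡ π)) (cong (π ⟨$⟩ˡ_) (sym (x∈⁅y⁆⇒x≡y _ y∈)))) (x∈⁅x⁆ x)))

  infix 4 _≈_

  -- The permutation `classes` is kept as data because it becomes the action on the points at
  -- infinity.
  record _≈_ {n} (𝒜 ℬ : AffinePlane n) : Set where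
    field
      points  : Permutation′ (n * n)
      classes : Permutation′ (suc n)
      lines   : Fin (suc n) → Permutation′ n
      law     : ∀ i k p → lookup (line 𝒜 i k) p
                  ≡ lookup (line ℬ (classes ⟨$⟩ʳ i) (lines i ⟨$⟩ʳ k)) (points ⟨$⟩ʳ p)

  ≈-sym : ∀ {n} {𝒜 ℬ : AffinePlane n} → 𝒜 ≈ ℬ → ℬ ≈ 𝒜
  ≈-sym {𝒜 = 𝒜} {ℬ} 𝒜≈ℬ = record
    { points  = flip points
    ; classes = flip classes
    ; lines   = λ i → flip (lines (classes ⟨$⟩ˡ i))
    ; law     = law′
    }
    where
    open _≈_ 𝒜≈ℬ
    law′ : ∀ i k p → lookup (line ℬ i k) p
             ≡ lookup (line 𝒜 (classes ⟨$⟩ˡ i) (lines (classes ⟨$⟩ˡ i) ⟨$⟩ˡ k)) (points ⟨$⟩ˡ p)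
    law′ i k p rewrite law (classes ⟨$⟩ˡ i) (lines (classes ⟨$⟩ˡ i) ⟨$⟩ˡ k) (points ⟨$⟩ˡ p)
                     | inverseʳ (lines (classes ⟨$⟩ˡ i)) {k} | inverseʳ classes {i} | inverseʳ points {p} = refl

  ≈-trans : ∀ {n} {𝒜 ℬ 𝒞 : AffinePlane n} → 𝒜 ≈ ℬ → ℬ ≈ 𝒞 → 𝒜 ≈ 𝒞
  ≈-trans f g = record
    { points  = F.points ∘ₚ G.points
    ; classes = F.classes ∘ₚ G.classes
    ; lines   = λ i → F.lines i ∘ₚ G.lines (F.classes ⟨$⟩ʳ i)
    ; law     = λ i k p → trans (F.law i k p) (G.law _ _ _)
    }
    where module F = _≈_ f
          module G = _≈_ g

  ≈⇒≅ : ∀ {n} (Π Π′ : ProjectivePlane n) →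
        ProjectivePlane.affinePlane Π ≈ ProjectivePlane.affinePlane Π′ → Π ≅ Π′
  ≈⇒≅ {n} Π Π′ 𝒜≈ℬ = record { bijection = π ; into = into ; onto = onto }
    where
    open _≈_ 𝒜≈ℬ
    open ≡-Reasoning
    𝒜 = ProjectivePlane.affinePlane Π
    ℬ = ProjectivePlane.affinePlane Π′

    π : Permutation′ (#points n)
    π = points ⊕ classes

    image-ℓ∞ : image π (⊥ {n * n} ++ ⊤ {suc n}) ≡ ⊥ {n * n} ++ ⊤ {suc n}
    image-ℓ∞ = trans (image-⊕ points classes ⊥ ⊤)
                     (cong₂ _++_ (image-replicate points _) (image-replicate classes _))

    image-line : ∀ i k → image points (line 𝒜 i k) ≡ line ℬ (classes ⟨$⟩ʳ i) (lines i ⟨$⟩ʳ k)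
    image-line i k = lookup-extensional λ y → begin
      lookup (image points (line 𝒜 i k)) y
        ≡⟨ lookup∘tabulate _ y ⟩
      lookup (line 𝒜 i k) (points ⟨$⟩ˡ y)
        ≡⟨ law i k (points ⟨$⟩ˡ y) ⟩
      lookup (line ℬ (classes ⟨$⟩ʳ i) (lines i ⟨$⟩ʳ k)) (points ⟨$⟩ʳ (points ⟨$⟩ˡ y))
        ≡⟨ cong (lookup (line ℬ _ _)) (inverseʳ points) ⟩
      lookup (line ℬ (classes ⟨$⟩ʳ i) (lines i ⟨$⟩ʳ k)) y ∎

    image-ℓ : ∀ i k → image π (line 𝒜 i k ++ ⁅ i ⁆)
                ≡ line ℬ (classes ⟨$⟩ʳ i) (lines i ⟨$⟩ʳ k) ++ ⁅ classes ⟨$⟩ʳ i ⁆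
    image-ℓ i k = trans (image-⊕ points classes (line 𝒜 i k) ⁅ i ⁆)
      (cong₂ _++_ (image-line i k) (image-⁅⁆ classes i))

    into : ∀ {ℓ} → IsLine Π ℓ → IsLine Π′ (image π ℓ)
    into ProjectivePlane.ℓ∞         = subst (IsLine Π′) (sym image-ℓ∞) ProjectivePlane.ℓ∞
    into ProjectivePlane.ℓ[ i , k ] = subst (IsLine Π′) (sym (image-ℓ i k)) ProjectivePlane.ℓ[ _ , _ ]

    onto : ∀ {ℓ′} → IsLine Π′ ℓ′ → ∃ λ ℓ → IsLine Π ℓ × image π ℓ ≡ ℓ′
    onto ProjectivePlane.ℓ∞         = _ , ProjectivePlane.ℓ∞ , image-ℓ∞
    onto ProjectivePlane.ℓ[ i , k ] =
      _ , ProjectivePlane.ℓ[ classes ⟨$⟩ˡ i , lines (classes ⟨$⟩ˡ i) ⟨$⟩ˡ k ] , onto-ℓ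
      where
      onto-ℓ : image π (line 𝒜 (classes ⟨$⟩ˡ i) (lines (classes ⟨$⟩ˡ i) ⟨$⟩ˡ k) ++ ⁅ classes ⟨$⟩ˡ i ⁆)
                 ≡ line ℬ i k ++ ⁅ i ⁆
      onto-ℓ rewrite image-ℓ (classes ⟨$⟩ˡ i) (lines (classes ⟨$⟩ˡ i) ⟨$⟩ˡ k)
                   | inverseʳ (lines (classes ⟨$⟩ˡ i)) {k} | inverseʳ classes {i} = refl

  -- The Desarguesian plane of order 7.

  affine : Fin 7 → Fin 7 → Fin 7 → Fin 7
  affine m b x = (toℕ m * toℕ x + toℕ b) mod 7

  toℕ-affine : ∀ m b x → toℕ (affine m b x) ≡ (toℕ m * toℕ x + toℕ b) % 7
  toℕ-affine m b x = toℕ-fromℕ< (m%n<n (toℕ m * toℕ x + toℕ b) 7)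

  -- Class 0 consists of the verticals x = k, class `suc m` of the lines of slope m. Concatenating
  -- the columns puts the point (x, y) at index `combine x y`.
  column : Fin 8 → Fin 7 → Fin 7 → Subset 7
  column zero    k x = replicate 7 (lookup ⁅ k ⁆ x)
  column (suc m) k x = ⁅ affine m k x ⁆

  desarguesianLine : Fin 8 → Fin 7 → Subset (7 * 7)
  desarguesianLine i k = concat (tabulate (column i k))

  lookup-line : ∀ i k x y → lookup (desarguesianLine i k) (combine x y) ≡ lookup (column i k x) y
  lookup-line i k x y = trans (lookup-concat (tabulate (column i k)) x y)
                              (cong (λ S → lookup S y) (lookup∘tabulate (column i k) x))

  opaque
    affine-injective : ∀ m x k l → affine m k x ≡ affine m l x → k ≡ l
    affine-injective = from-yes (all? λ m → all? λ x → all? λ k → all? λ l →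
      (affine m k x ≟ affine m l x) →-dec (k ≟ l))

    line-size : ∀ i k → ∣ desarguesianLine i k ∣ ≡ 7
    line-size = from-yes (all? λ i → all? λ k → ∣ desarguesianLine i k ∣ ℕ.≟ 7)

    line-meet : ∀ i j → i ≡ j ⊎ (∀ k l → ∣ desarguesianLine i k ∩ desarguesianLine j l ∣ ≡ 1)
    line-meet = from-yes (all? λ i → all? λ j → (i ≟ j) ⊎-dec
      (all? λ k → all? λ l → ∣ desarguesianLine i k ∩ desarguesianLine j l ∣ ℕ.≟ 1))

  column-disjoint : ∀ i {k l x y} → y ∈ column i k x → y ∈ column i l x → k ≡ l
  column-disjoint zero {k} {l} {x} {y} ∈k ∈l = trans (sym (on ∈k)) (on ∈l)
    where
    on : ∀ {k} → y ∈ column zero k x → x ≡ k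
    on {k} ∈k = x∈⁅y⁆⇒x≡y k (lookup⇒[]= x ⁅ k ⁆ (trans (sym (lookup-replicate y _)) ([]=⇒lookup ∈k)))
  column-disjoint (suc m) {k} {l} {x} ∈k ∈l =
    affine-injective m x k l (trans (sym (x∈⁅y⁆⇒x≡y _ ∈k)) (x∈⁅y⁆⇒x≡y _ ∈l))

  line-disjoint : ∀ i {k l p} → p ∈ desarguesianLine i k → p ∈ desarguesianLine i l → k ≡ l
  line-disjoint i {k} {l} {p} ∈k ∈l with x , y , refl ← combine-surjective {7} {7} p =
    column-disjoint i {x = x} {y} (inColumn k ∈k) (inColumn l ∈l)
    where
    inColumn : ∀ k → combine x y ∈ desarguesianLine i k → y ∈ column i k x
    inColumn k ∈k = lookup⇒[]= y _ (trans (sym (lookup-line i k x y)) ([]=⇒lookup ∈k))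

  desarguesian : AffinePlane 7
  desarguesian = record
    { line     = desarguesianLine
    ; size     = line-size
    -- Two equal lines would have an intersection of both 7 points and none.
    ; distinct = λ i {k} {l} k≢l e → contradiction
        (trans (sym (line-size i k)) (trans (cong ∣_∣ (sym (∩-idem (desarguesianLine i k))))
          (trans (cong (λ ℓ → ∣ desarguesianLine i k ∩ ℓ ∣) e) (empty i k≢l))))
        λ ()
    ; disjoint = λ i k≢l (p , p∈) → let ∈k , ∈l = x∈p∩q⁻ _ _ p∈ in k≢l (line-disjoint i ∈k ∈l)
    ; meet     = λ {i} {j} i≢j → [ (λ i≡j → contradiction i≡j i≢j) , id ]′ (line-meet i j)
    }
    where
    empty : ∀ i {k l} → k ≢ l → ∣ desarguesianLine i k ∩ desarguesianLine i l ∣ ≡ 0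
    empty i {k} {l} k≢l = trans (cong ∣_∣ (Empty-unique λ (p , p∈) →
      let ∈k , ∈l = x∈p∩q⁻ (desarguesianLine i k) (desarguesianLine i l) p∈ in k≢l (line-disjoint i ∈k ∈l)))
      (∣⊥∣≡0 49)

  affine-zero : ∀ b x → affine 0F b x ≡ b
  affine-zero b x = toℕ-injective (trans (toℕ-affine 0F b x) (m<n⇒m%n≡m (toℕ<n b)))

  -- Identification of every affine plane of order 7 with the Desarguesian one.

  module _ (𝒜 : AffinePlane 7) where
    open Coordinates 𝒜
    open Linear (linearCoordinates net)

    private
      abscissa′ ordinate′ : Fin (7 * 7) → Fin 7
      abscissa′ p = α ⟨$⟩ʳ class 0F p
      ordinate′ p = β ⟨$⟩ʳ class 1F p

      place : Fin (7 * 7) → Fin (7 * 7)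
      place p = combine (abscissa′ p) (ordinate′ p)

      place-injective : ∀ {p q} → place p ≡ place q → p ≡ q
      place-injective {p} {q} e =
        let eₓ , eᵧ = combine-injective (abscissa′ p) (ordinate′ p) (abscissa′ q) (ordinate′ q) e
        in  class-joint-injective {0F} {1F} (λ ()) (permutation-injective α eₓ) (permutation-injective β eᵧ)

      relabel : Fin 8 → Permutation′ 7
      relabel zero          = α
      relabel (suc zero)    = β
      relabel (suc (suc c)) = δ c

      -- Class 1, at index `zero` here, becomes the horizontals because `μ` fixes 0; the other
      -- classes follow the linear law of the net.
      ordinate-affine : ∀ i p → ordinate′ p ≡
        affine (μ ⟨$⟩ʳ i) (relabel (suc i) ⟨$⟩ʳ class (suc i) p) (abscissa′ p)
      ordinate-affine zero    p = sym (trans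
        (cong (λ m → affine m (ordinate′ p) (abscissa′ p)) μ0) (affine-zero (ordinate′ p) (abscissa′ p)))
      ordinate-affine (suc c) p = toℕ-injective (begin
        toℕ (β ⟨$⟩ʳ class 1F p)
          ≡⟨ cong (λ y → toℕ (β ⟨$⟩ʳ y)) (ordinate-class c p) ⟨
        toℕ (β ⟨$⟩ʳ ordinate c (class (suc (suc c)) p) (class 0F p))
          ≡⟨ law c (class (suc (suc c)) p) (class 0F p) ⟩
        (toℕ (μ ⟨$⟩ʳ suc c) * toℕ (abscissa′ p) + toℕ (δ c ⟨$⟩ʳ class (suc (suc c)) p)) % 7
          ≡⟨ toℕ-affine (μ ⟨$⟩ʳ suc c) (δ c ⟨$⟩ʳ class (suc (suc c)) p) (abscissa′ p) ⟨
        toℕ (affine (μ ⟨$⟩ʳ suc c) (δ c ⟨$⟩ʳ class (suc (suc c)) p) (abscissa′ p)) ∎)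
        where open ≡-Reasoning

      -- A point lies on line k exactly when k is its label in the class. For a fixed slope and
      -- abscissa, the intercept is determined by the ordinate, so the relabelled equation detects
      -- that label.
      column-law : ∀ i k p → lookup (line 𝒜 i k) p
        ≡ lookup (column (lift₀ μ ⟨$⟩ʳ i) (relabel i ⟨$⟩ʳ k) (abscissa′ p)) (ordinate′ p)
      column-law zero    k p = trans
        (lookup-⇔ {S = line 𝒜 zero k} {T = ⁅ α ⟨$⟩ʳ k ⁆}
          (λ p∈ → subst (λ l → abscissa′ p ∈ ⁅ α ⟨$⟩ʳ l ⁆) (class-≡ p∈) (x∈⁅x⁆ _))
          (λ x∈ → ∈-class-≡ (permutation-injective α (x∈⁅y⁆⇒x≡y _ x∈))))
        (sym (lookup-replicate (ordinate′ p) _))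
      column-law (suc i) k p = lookup-⇔ {S = line 𝒜 (suc i) k}
          {T = ⁅ affine (μ ⟨$⟩ʳ i) (relabel (suc i) ⟨$⟩ʳ k) (abscissa′ p) ⁆}
        (λ p∈ → subst (_∈ ⁅ affine (μ ⟨$⟩ʳ i) (relabel (suc i) ⟨$⟩ʳ k) (abscissa′ p) ⁆) (sym (trans
          (ordinate-affine i p)
          (cong (λ l → affine (μ ⟨$⟩ʳ i) (relabel (suc i) ⟨$⟩ʳ l) (abscissa′ p)) (class-≡ p∈)))) (x∈⁅x⁆ _))
        (λ y∈ → ∈-class-≡ (permutation-injective (relabel (suc i)) (affine-injective (μ ⟨$⟩ʳ i) (abscissa′ p) _ _
          (trans (sym (ordinate-affine i p)) (x∈⁅y⁆⇒x≡y _ y∈)))))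

    ≈-desarguesian : 𝒜 ≈ desarguesian
    ≈-desarguesian = record
      { points  = injective⇒permutation place place-injective
      ; classes = lift₀ μ
      ; lines   = relabel
      ; law     = λ i k p → trans (column-law i k p)
          (sym (lookup-line (lift₀ μ ⟨$⟩ʳ i) (relabel i ⟨$⟩ʳ k) (abscissa′ p) (ordinate′ p)))
      }

  -- Both planes are matched with the same model, each line at infinity going to the line at
  -- infinity.
  ≅-unique : (Π Π′ : ProjectivePlane 7) → Π ≅ Π′
  ≅-unique Π Π′ = ≈⇒≅ Π Π′ (≈-trans (≈-desarguesian _) (≈-sym (≈-desarguesian _)))

theorem2p4 : (¬ AffinePlane 6 × ¬ ProjectivePlane 6)
    × (ProjectivePlane 7 × ((Π Π′ : ProjectivePlane 7) → Π ≅ Π′))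
theorem2p4 = (¬AffinePlane6 , ¬AffinePlane6 ∘ ProjectivePlane.affinePlane)
           , record { affinePlane = Planes.desarguesian } , Planes.≅-unique
  where open OrderSix using (¬AffinePlane6)
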